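{- The following two statements hold: (i) Weakly guarded LLEE-$\mathbf 1$-charts are not in general LLEE-preservingly $\mathbf 1$-collapsible, and hence not in general LLEE-preservingly collapsible. (ii) Two $\mathbf 1$-bisimilar weakly guarded LLEE-$\mathbf 1$-charts are not in general LLEE-preservingly jointly minimizable under functional $\mathbf 1$-bisimilarity. More specifically, let $a,b,c,d,e,f,a_1,a_2,c_1,c_2$ be pairwise distinct actions and let $\mathcal{C}$ be the $\mathbf 1$-chart with ten vertices $v,\bar w_1,x_1,x_2,y_1,y_2,w_1,w_2,z,u$, start vertex $v$, no terminating vertices, and precisely the following transitions: - from $v$: $v\xrightarrow{a}x_1$, $v\xrightarrow{a}x_2$, $v\xrightarrow{c}y_1$, $v\xrightarrow{c}y_2$, $v\xrightarrow{b}u$; - from $\bar w_1$: $\bar w_1\xrightarrow{a}x_1$, $\bar w_1\xrightarrow{a}x_2$, $\bar w_1\xrightarrow{c}y_1$, $\bar w_1\xrightarrow{c}y_2$, $\bar w_1\xrightarrow{d}z$; - from $x_i$ ($i=1,2$): $x_i\xrightarrow{a_i}w_2$, $x_i\xrightarrow{a_i}v$; - from $y_i$ ($i=1,2$): $y_i\xrightarrow{c_i}w_1$, $y_i\xrightarrow{c_i}\bar w_1$; - from $w_1$: $w_1\xrightarrow{b}u$, $w_1\xrightarrow{\mathbf 1}\bar w_1$; - from $w_2$: $w_2\xrightarrow{d}z$, $w_2\xrightarrow{\mathbf 1}v$; - from $z$ and $u$: $z\xrightarrow{e}v$, $u\xrightarrow{f}\bar w_1$. Then $\mathcal{C}$ is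 a weakly guarded LLEE-$\mathbf 1$-chart that witnesses (i), and the generated sub-$\mathbf 1$-charts of $\mathcal{C}$ at $w_1$ and at $w_2$ are $\mathbf 1$-bisimilar weakly guarded LLEE-$\mathbf 1$-charts that witness (ii).
   Context: **$\mathbf 1$-charts.** A $\mathbf 1$-chart is a tuple $\langle V,A,\mathbf 1,v_s,\to,\downarrow\rangle$ with $V$ a finite set of vertices, $A$ a finite set of (proper) action labels, $\mathbf 1\notin A$ the empty-step label, $v_s\in V$ the start vertex, $\to\;\subseteq V\times(A\cup\{\mathbf 1\})\times V$ the labeled transitions, and $\downarrow\;\subseteq V$ the set of (immediately) terminating vertices. Transitions labeled by $\mathbf 1$ are $\mathbf 1$-transitions; the others are proper transitions. It is weakly guarded if it has no infinite path of $\mathbf 1$-transitions. The generated sub-$\mathbf 1$-chart at $w\in V$ is obtained by making $w$ the start vertex (and keeping the part that is reachable from $w$). **Induced transitions and termination.** $v\xrightarrow{(a]}w$, for $a\in A$, means that there is a path of finitely many (possibly zero) $\mathbf 1$-transitions from $v$ followed by a proper transition with label $a$ to $w$. Induced termination $v{\downarrow}^{(\mathbf 1)}$ means that there is a path of (possibly zero) $\mathbf 1$-transitions from $v$ to a terminating vertex. **$\mathbf 1$-bisimulations.** A $\mathbf 1$-bisimulation between $\mathbf 1$-charts $\mathcal{C}_1$ and $\mathcal{C}_2$ with vertex sets $V_1,V_2$ is a relation $B\subseteq V_1\times V_2$ that relates the start vertices and is such that for all $\langle v_1,v_2\rangle\in B$: (forth) if $v_1\xrightarrow{(a]}v_1'$,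 then $v_2\xrightarrow{(a]}v_2'$ with $\langle v_1',v_2'\rangle\in B$ for some $v_2'$; (back) if $v_2\xrightarrow{(a]}v_2'$, then $v_1\xrightarrow{(a]}v_1'$ with $\langle v_1',v_2'\rangle\in B$ for some $v_1'$; (termination) $v_1{\downarrow}^{(\mathbf 1)}$ iff $v_2{\downarrow}^{(\mathbf 1)}$. It is a functional $\mathbf 1$-bisimulation from $\mathcal{C}_1$ to $\mathcal{C}_2$ if it is the graph of a partial function from $V_1$ to $V_2$. $\mathcal{C}_1$ and $\mathcal{C}_2$ are $\mathbf 1$-bisimilar if there is a $\mathbf 1$-bisimulation between them. Vertices of one $\mathbf 1$-chart $\mathcal{D}$ are $\mathbf 1$-bisimilar if they are related by the largest $\mathbf 1$-bisimulation between $\mathcal{D}$ and itself. $\mathcal{D}$ is $\mathbf 1$-collapsed (a $\mathbf 1$-bisimulation collapse) if $\mathbf 1$-bisimilar vertices are identical. It is collapsed (a bisimulation collapse) if moreover it has no $\mathbf 1$-transitions. A ($\mathbf 1$-)bisimulation collapse of $\mathcal{C}$ is a ($\mathbf 1$-)bisimulation collapse that is $\mathbf 1$-bisimilar to $\mathcal{C}$. **Loop existence and elimination.** A loop $\mathbf 1$-chart is a $\mathbf 1$-chart with start vertex $v_s$ such that (L1) there is an infinite path from $v_s$; (L2) every infinite path from $v_s$ returns to $v_s$ after a positive number of transitions; (L3) $\downarrow\;\subseteq\{v_s\}$. A loop sub-$\mathbf 1$-chart of $\mathcal{C}$ is a loop $\mathbf 1$-chart that, for some vertex $v$ (its start vertex)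 and some nonempty set $U$ of transitions of $\mathcal{C}$ from $v$ (its loop-entry transitions), consists of all vertices and transitions on paths that start with a transition in $U$ and continue onward until $v$ is reached again, with termination inherited from $\mathcal{C}$. Its other transitions form its body. Eliminating it from $\mathcal{C}$ means removing the transitions in $U$ from $\mathcal{C}$, and then all vertices and transitions that become unreachable from the start vertex. $\mathcal{C}$ satisfies LEE if some repeated elimination of loop sub-$\mathbf 1$-charts starting from $\mathcal{C}$ results in a $\mathbf 1$-chart without an infinite path. $\mathcal{C}$ satisfies LLEE (layered LEE), and is then called an LLEE-$\mathbf 1$-chart, if there is such a successful elimination process in which loop-entry transitions are never removed from the body of a previously eliminated loop sub-$\mathbf 1$-chart. **Collapsibility notions.** An LLEE-$\mathbf 1$-chart $\mathcal{C}$ is LLEE-preservingly $\mathbf 1$-collapsible if it has a $\mathbf 1$-bisimulation collapse that is an LLEE-$\mathbf 1$-chart. It is LLEE-preservingly collapsible if its bisimulation collapse is an LLEE-$\mathbf 1$-chart. Two $\mathbf 1$-bisimilar LLEE-$\mathbf 1$-charts $\mathcal{C}_1,\mathcal{C}_2$ are LLEE-preservingly jointly minimizable (under functional $\mathbf 1$-bisimilarity) if there is an LLEE-$\mathbf 1$-chart $\mathcal{C}_0$ such that there are functional $\mathbf 1$-bisimulations from $\mathcal{C}_1$ to $\mathcal{C}_0$ and from $\mathcal{C}_2$ to $\mathcal{C}_0$. -}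

module Defs where

open import Level using (0ℓ)
open import Data.Nat.Base using (ℕ; suc)
open import Data.Fin.Base using (Fin; zero; suc)
open import Data.Maybe.Base using (Maybe; just; nothing)
open import Data.Product using (Σ; ∃; ∃-syntax; _×_; _,_)
open import Data.Sum.Base using (_⊎_; inj₁; inj₂)
open import Data.Unit.Base using (⊤; tt)
open import Function.Bundles using (_↔_; mk↔ₛ′; _⇔_)
open import Relation.Binary.Construct.Closure.ReflexiveTransitive using (Star; ε; _◅_; _◅◅_)
open import Relation.Binary.Core using (Rel; REL)
open import Relation.Binary.PropositionalEquality.Core using (_≡_; _≢_; refl)
open import Relation.Nullary.Negation using (¬_)
open import Relation.Unary using (Pred; _∈_; _⊆_; _∪_; ∅; _⊥_; Satisfiable) renaming (U to Univ)

Finite : Set → Set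
Finite X = ∃[ n ] (X ↔ Fin n)

-- The labels A ∪ {𝟏}, with 𝟏 ∉ A.
Label : Set → Set
Label A = Maybe A

pattern 𝟏     = nothing
pattern act a = just a

TransitionSet : Set → Set → Set₁
TransitionSet A X = Pred (X × Label A × X) 0ℓ

-- The vertices form a subset V of a finite ambient type X, so that sub-𝟏-charts
-- are charts over the same X.  The subsets are not assumed to be decidable.
record OneChart (A X : Set) : Set₁ where
  field
    finite-A : Finite A
    finite-X : Finite X
    V        : Pred X 0ℓ
    start    : X
    start∈V  : start ∈ V
    trans    : TransitionSet A X
    source∈V : ∀ {x l y} → trans (x , l , y) → x ∈ V
    target∈V : ∀ {x l y} → trans (x , l , y) → y ∈ V
    term     : Pred X 0ℓ
    term⊆V   : term ⊆ V

  Step : Rel X 0ℓ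
  Step x y = ∃[ l ] trans (x , l , y)

  OneStep : Rel X 0ℓ
  OneStep x y = trans (x , 𝟏 , y)

  Reachable : Rel X 0ℓ
  Reachable = Star Step

  -- x ─(a]→ y
  Induced : X → A → X → Set
  Induced x a y = ∃[ x′ ] (Star OneStep x x′ × trans (x′ , act a , y))

  -- x ↓⁽¹⁾
  InducedTerm : X → Set
  InducedTerm x = ∃[ x′ ] (Star OneStep x x′ × x′ ∈ term)

open OneChart

IsInfinitePath : {X : Set} → Rel X 0ℓ → (ℕ → X) → Set
IsInfinitePath R p = ∀ i → R (p i) (p (suc i))

HasInfinitePath : {X : Set} → Rel X 0ℓ → Set
HasInfinitePath R = ∃[ p ] IsInfinitePath R p

WeaklyGuarded : ∀ {A X} → OneChart A X → Set
WeaklyGuarded C = ¬ HasInfinitePath (OneStep C)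

reachable∈V : ∀ {A X} (C : OneChart A X) {w x} → w ∈ V C → Reachable C w x → x ∈ V C
reachable∈V C w∈V ε              = w∈V
reachable∈V C w∈V ((_ , t) ◅ ts) = reachable∈V C (target∈V C t) ts

generated : ∀ {A X} (C : OneChart A X) (w : X) → w ∈ V C → OneChart A X
generated C w w∈V = record
  { finite-A = finite-A C
  ; finite-X = finite-X C
  ; V        = Reachable C w
  ; start    = w
  ; start∈V  = ε
  ; trans    = λ (x , l , y) → Reachable C w x × trans C (x , l , y)
  ; source∈V = λ (r , _) → r
  ; target∈V = λ (r , t) → r ◅◅ ((_ , t) ◅ ε)
  ; term     = λ x → Reachable C w x × x ∈ term C
  ; term⊆V   = λ (r , _) → r
  }

record IsOneBisimulation {A X₁ X₂ : Set} (C₁ : OneChart A X₁) (C₂ : OneChart A X₂)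
                         (B : REL X₁ X₂ 0ℓ) : Set where
  field
    onVertices  : ∀ {x₁ x₂} → B x₁ x₂ → x₁ ∈ V C₁ × x₂ ∈ V C₂
    startRel    : B (start C₁) (start C₂)
    forth       : ∀ {x₁ x₂ a y₁} → B x₁ x₂ → Induced C₁ x₁ a y₁ →
                  ∃[ y₂ ] (Induced C₂ x₂ a y₂ × B y₁ y₂)
    back        : ∀ {x₁ x₂ a y₂} → B x₁ x₂ → Induced C₂ x₂ a y₂ →
                  ∃[ y₁ ] (Induced C₁ x₁ a y₁ × B y₁ y₂)
    termination : ∀ {x₁ x₂} → B x₁ x₂ → InducedTerm C₁ x₁ ⇔ InducedTerm C₂ x₂

OneBisimilar : ∀ {A X₁ X₂} → OneChart A X₁ → OneChart A X₂ → Set₁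
OneBisimilar C₁ C₂ = Σ _ (IsOneBisimulation C₁ C₂)

IsFunctionalOneBisimulation : ∀ {A X₁ X₂} → OneChart A X₁ → OneChart A X₂ →
                              REL X₁ X₂ 0ℓ → Set
IsFunctionalOneBisimulation C₁ C₂ B =
  IsOneBisimulation C₁ C₂ B × (∀ {x y y′} → B x y → B x y′ → y ≡ y′)

-- The largest 𝟏-bisimulation between D and itself: the union of all of them.
OneBisimilarIn : ∀ {A X} → OneChart A X → X → X → Set₁
OneBisimilarIn D x y = Σ _ λ B → IsOneBisimulation D D B × B x y

OneCollapsed : ∀ {A X} → OneChart A X → Set₁
OneCollapsed D = ∀ {x y} → OneBisimilarIn D x y → x ≡ y

Collapsed : ∀ {A X} → OneChart A X → Set₁
Collapsed D = OneCollapsed D × (∀ {x y} → ¬ OneStep D x y)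

record IsLoopChart {A X : Set} (C : OneChart A X) : Set where
  field
    L1 : ∃[ p ] (IsInfinitePath (Step C) p × p 0 ≡ start C)
    L2 : ∀ p → IsInfinitePath (Step C) p → p 0 ≡ start C → ∃[ n ] p (suc n) ≡ start C
    L3 : ∀ {x} → x ∈ term C → x ≡ start C

record EntrySet {A X : Set} (C : OneChart A X) : Set₁ where
  field
    v        : X
    U        : TransitionSet A X
    U⊆trans  : U ⊆ trans C
    U-from-v : ∀ {x l y} → U (x , l , y) → x ≡ v
    nonempty : Satisfiable U

module _ {A X : Set} {C : OneChart A X} (E : EntrySet C) where
  open EntrySet E

  -- Vertices after at least one transition on a path that starts with a
  -- transition in U and is not continued once v is reached again.
  data Visited : X → Set where
    enter    : ∀ {l y} → U (v , l , y) → Visited y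
    continue : ∀ {x l y} → Visited x → x ≢ v → trans C (x , l , y) → Visited y

  Body : TransitionSet A X
  Body (x , l , y) = Visited x × x ≢ v × trans C (x , l , y)

  LoopVertex : Pred X 0ℓ
  LoopVertex x = x ≡ v ⊎ Visited x

  private
    v∈V : v ∈ V C
    v∈V with nonempty
    ... | _ , u with U-from-v u
    ...   | refl = source∈V C (U⊆trans u)

    visited∈V : Visited ⊆ V C
    visited∈V (enter u)        = target∈V C (U⊆trans u)
    visited∈V (continue _ _ t) = target∈V C t

    source∈ : ∀ {x l y} → (U ∪ Body) (x , l , y) → LoopVertex x
    source∈ (inj₁ u)       = inj₁ (U-from-v u)
    source∈ (inj₂ (p , _)) = inj₂ p

    target∈ : ∀ {x l y} → (U ∪ Body) (x , l , y) → LoopVertex y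
    target∈ (inj₁ u) with U-from-v u
    ... | refl = inj₂ (enter u)
    target∈ (inj₂ (p , x≢v , t)) = inj₂ (continue p x≢v t)

  loopSubchart : OneChart A X
  loopSubchart = record
    { finite-A = finite-A C
    ; finite-X = finite-X C
    ; V        = LoopVertex
    ; start    = v
    ; start∈V  = inj₁ refl
    ; trans    = U ∪ Body
    ; source∈V = source∈
    ; target∈V = target∈
    ; term     = λ x → LoopVertex x × x ∈ term C
    ; term⊆V   = λ (p , _) → p
    }

removeTransitions : ∀ {A X} → OneChart A X → TransitionSet A X → OneChart A X
removeTransitions C U = record C
  { trans    = λ t → trans C t × ¬ U t
  ; source∈V = λ (t , _) → source∈V C t
  ; target∈V = λ (t , _) → target∈V C t
  }

record LoopSubchart {A X : Set} (C : OneChart A X) : Set₁ where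
  field
    entries     : EntrySet C
    isLoopChart : IsLoopChart (loopSubchart entries)

  open EntrySet entries public using (U)

  body : TransitionSet A X
  body = Body entries

  eliminate : OneChart A X
  eliminate = generated (removeTransitions C U) (start C) (start∈V C)

open LoopSubchart

infixr 5 _∷_

data Elimination {A X : Set} (C : OneChart A X) : OneChart A X → Set₁ where
  []  : Elimination C C
  _∷_ : ∀ {C′} (S : LoopSubchart C) → Elimination (eliminate S) C′ → Elimination C C′

-- No loop-entry transition removed lies in F or in the body of a loop
-- sub-𝟏-chart eliminated earlier in the process.
LayeredFrom : ∀ {A X} {C C′ : OneChart A X} → TransitionSet A X → Elimination C C′ → Set
LayeredFrom F []       = ⊤
LayeredFrom F (S ∷ es) = (U S ⊥ F) × LayeredFrom (F ∪ body S) es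

LEE : ∀ {A X} → OneChart A X → Set₁
LEE C = ∃[ C′ ] (Elimination C C′ × ¬ HasInfinitePath (Step C′))

LLEE : ∀ {A X} → OneChart A X → Set₁
LLEE C = ∃[ C′ ] Σ (Elimination C C′) λ es →
  LayeredFrom ∅ es × ¬ HasInfinitePath (Step C′)

LLEEPreservinglyOneCollapsible : ∀ {A X} → OneChart A X → Set₁
LLEEPreservinglyOneCollapsible {A} C =
  Σ Set λ Y → Σ (OneChart A Y) λ D → OneCollapsed D × OneBisimilar D C × LLEE D

LLEEPreservinglyCollapsible : ∀ {A X} → OneChart A X → Set₁
LLEEPreservinglyCollapsible {A} C =
  Σ Set λ Y → Σ (OneChart A Y) λ D → Collapsed D × OneBisimilar D C × LLEE D

LLEEPreservinglyJointlyMinimizable : ∀ {A X₁ X₂} → OneChart A X₁ → OneChart A X₂ → Set₁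
LLEEPreservinglyJointlyMinimizable {A} C₁ C₂ =
  Σ Set λ Y → Σ (OneChart A Y) λ C₀ → LLEE C₀
    × Σ _ (IsFunctionalOneBisimulation C₁ C₀)
    × Σ _ (IsFunctionalOneBisimulation C₂ C₀)

data Vtx : Set where
  v w̄₁ x₁ x₂ y₁ y₂ w₁ w₂ z u : Vtx

finite-Vtx : Finite Vtx
finite-Vtx = 10 , mk↔ₛ′ to from to∘from from∘to
  where
  pattern suc2 i = suc (suc i)
  pattern suc4 i = suc2 (suc2 i)
  pattern suc8 i = suc4 (suc4 i)

  to : Vtx → Fin 10
  to v  = zero
  to w̄₁ = suc zero
  to x₁ = suc2 zero
  to x₂ = suc2 (suc zero)
  to y₁ = suc4 zero
  to y₂ = suc4 (suc zero)
  to w₁ = suc4 (suc2 zero)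
  to w₂ = suc4 (suc2 (suc zero))
  to z  = suc8 zero
  to u  = suc8 (suc zero)

  from : Fin 10 → Vtx
  from zero                     = v
  from (suc zero)               = w̄₁
  from (suc2 zero)              = x₁
  from (suc2 (suc zero))        = x₂
  from (suc4 zero)              = y₁
  from (suc4 (suc zero))        = y₂
  from (suc4 (suc2 zero))       = w₁
  from (suc4 (suc2 (suc zero))) = w₂
  from (suc8 zero)              = z
  from (suc8 (suc zero))        = u

  to∘from : ∀ i → to (from i) ≡ i
  to∘from zero                     = refl
  to∘from (suc zero)               = refl
  to∘from (suc2 zero)              = refl
  to∘from (suc2 (suc zero))        = refl
  to∘from (suc4 zero)              = refl
  to∘from (suc4 (suc zero))        = refl
  to∘from (suc4 (suc2 zero))       = refl
  to∘from (suc4 (suc2 (suc zero))) = refl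
  to∘from (suc8 zero)              = refl
  to∘from (suc8 (suc zero))        = refl

  from∘to : ∀ x → from (to x) ≡ x
  from∘to v  = refl
  from∘to w̄₁ = refl
  from∘to x₁ = refl
  from∘to x₂ = refl
  from∘to y₁ = refl
  from∘to y₂ = refl
  from∘to w₁ = refl
  from∘to w₂ = refl
  from∘to z  = refl
  from∘to u  = refl

module Counterexample {A : Set} (finite-A : Finite A) (a b c d e f a₁ a₂ c₁ c₂ : A) where

  data Trans : TransitionSet A Vtx where
    v-x₁   : Trans (v , act a , x₁)
    v-x₂   : Trans (v , act a , x₂)
    v-y₁   : Trans (v , act c , y₁)
    v-y₂   : Trans (v , act c , y₂)
    v-u    : Trans (v , act b , u)
    w̄₁-x₁  : Trans (w̄₁ , act a , x₁)
    w̄₁-x₂  : Trans (w̄₁ , act a , x₂)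
    w̄₁-y₁  : Trans (w̄₁ , act c , y₁)
    w̄₁-y₂  : Trans (w̄₁ , act c , y₂)
    w̄₁-z   : Trans (w̄₁ , act d , z)
    x₁-w₂  : Trans (x₁ , act a₁ , w₂)
    x₁-v   : Trans (x₁ , act a₁ , v)
    x₂-w₂  : Trans (x₂ , act a₂ , w₂)
    x₂-v   : Trans (x₂ , act a₂ , v)
    y₁-w₁  : Trans (y₁ , act c₁ , w₁)
    y₁-w̄₁  : Trans (y₁ , act c₁ , w̄₁)
    y₂-w₁  : Trans (y₂ , act c₂ , w₁)
    y₂-w̄₁  : Trans (y₂ , act c₂ , w̄₁)
    w₁-u   : Trans (w₁ , act b , u)
    w₁-w̄₁  : Trans (w₁ , 𝟏 , w̄₁)
    w₂-z   : Trans (w₂ , act d , z)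
    w₂-v   : Trans (w₂ , 𝟏 , v)
    z-v    : Trans (z , act e , v)
    u-w̄₁   : Trans (u , act f , w̄₁)

  𝒞 : OneChart A Vtx
  𝒞 = record
    { finite-A = finite-A
    ; finite-X = finite-Vtx
    ; V        = Univ
    ; start    = v
    ; start∈V  = tt
    ; trans    = Trans
    ; source∈V = λ _ → tt
    ; target∈V = λ _ → tt
    ; term     = ∅
    ; term⊆V   = λ ()
    }

  𝒞-at : Vtx → OneChart A Vtx
  𝒞-at w = generated 𝒞 w tt

{-# OPTIONS --safe #-}
module Submission where

-- Non-collapsibility.  Call a set G of transitions persistent if every transition x → y of G can
-- be continued inside G to an infinite path that never returns to x.  By (L2) no transition of G
-- is ever a loop-entry transition, so G survives every elimination, and LEE fails; layeredness
-- plays no role.  A collapse of 𝒞, and likewise a joint minimization of 𝒞-at w₁ and 𝒞-at w₂, has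
-- a single vertex Ŵ for w₁ and w₂ both, so that Ŵ must enable b like v, and d like w̄₁.  G consists
-- of the paths that realise induced transitions between the images of the vertices of 𝒞.  Such
-- paths may share vertices reached by 𝟏-transitions, but a vertex on a path for p ─(l]→ q is on
-- no path from a p′ that does not enable l; this yields the infinite paths avoiding x.  If the
-- b-step of Ŵ must go through a vertex that behaves like v (or its d-step through one that behaves
-- like w̄₁), then the transitions from v to the xᵢ (or from w̄₁ to the yᵢ) may be eliminable; a
-- smaller G that omits the xᵢ (or the yᵢ) is persistent in that case.

open import Defs
open import Level using (0ℓ)
open import Data.Bool.Base using (Bool; true; false; not; T)
open import Data.Fin.Base as Fin using (Fin)
open import Data.Fin.Patterns
import Data.Fin.Properties as Fin
open import Data.List.Base using (List; []; _∷_; lookup)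
open import Data.List.Membership.Propositional.Properties using (∈-lookup)
open import Data.List.Relation.Unary.All as All using ()
open import Data.List.Relation.Unary.AllPairs using (_∷_)
open import Data.List.Relation.Unary.Unique.Propositional using (Unique)
open import Data.List.Relation.Unary.Unique.Propositional.Properties using (allFin⁺)
open import Data.Maybe.Base using (Maybe; just; nothing)
open import Data.Maybe.Properties using (just-injective)
open import Data.Nat.Base using (ℕ; zero; suc; _≤_; _<_; _≤ᵇ_; z≤n; s≤s)
import Data.Nat.Properties as ℕ
open import Data.Product using (Σ; Σ-syntax; ∃; ∃-syntax; _×_; _,_; proj₁; proj₂; map₂)
open import Data.Sum.Base using (_⊎_; inj₁; inj₂)
open import Data.Unit.Base using (⊤; tt)
open import Function.Base using (_∘_; flip; id)
open import Function.Bundles using (mk⇔)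
open import Function.Construct.Composition using (_⇔-∘_)
open import Function.Construct.Identity using (↔-id)
open import Function.Construct.Symmetry using (⇔-sym)
open import Function.Properties.Inverse using (↔⇒↣)
open import Relation.Binary.Construct.Closure.ReflexiveTransitive as Star
  using (Star; ε; _◅_; _◅◅_)
open import Relation.Binary.Core using (Rel; REL)
open import Relation.Binary.Definitions using (DecidableEquality)
open import Relation.Binary.PropositionalEquality.Core
  using (_≡_; _≢_; refl; sym; trans; cong; subst)
open import Relation.Nullary.Decidable
  using (yes; no; via-injection; ¬¬-excluded-middle; _⊎-dec_; toSum)
open import Relation.Nullary.Negation using (¬_; contradiction)
open import Relation.Unary using (Pred; _⊆_; _∪_; ∅; _⊥_; Satisfiable; Decidable)

open OneChart using (V; start; finite-X; term; Step; OneStep; Reachable; Induced)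
  renaming (trans to Trans[_])
open LoopSubchart using (entries; isLoopChart; eliminate; body; U)

private
  variable
    A X Y : Set

-- Decidable equality on finite types, and lookup in duplicate-free lists

Finite⇒≟ : Finite X → DecidableEquality X
Finite⇒≟ (_ , X↔Fin) = via-injection (↔⇒↣ X↔Fin) Fin._≟_

lookup-injective : ∀ {xs : List X} → Unique xs → ∀ {i j} → lookup xs i ≡ lookup xs j → i ≡ j
lookup-injective (_ ∷ _)   {Fin.zero}  {Fin.zero}  _  = refl
lookup-injective (x∉ ∷ _)  {Fin.zero}  {Fin.suc j} eq =
  contradiction eq (All.lookup x∉ (∈-lookup j))
lookup-injective (x∉ ∷ _)  {Fin.suc i} {Fin.zero}  eq =
  contradiction (sym eq) (All.lookup x∉ (∈-lookup i))
lookup-injective (_ ∷ xs!) {Fin.suc i} {Fin.suc j} eq =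
  cong Fin.suc (lookup-injective xs! eq)

-- 𝟏-bisimulations and induced transitions

Enables : OneChart A X → X → A → Set
Enables C x l = ∃[ y ] Induced C x l y

module _ {A X Y : Set} {C : OneChart A X} {D : OneChart A Y} where

  open IsOneBisimulation

  converse : ∀ {B} → IsOneBisimulation C D B → IsOneBisimulation D C (flip B)
  converse β = record
    { onVertices  = λ b → let p , q = onVertices β b in q , p
    ; startRel    = startRel β
    ; forth       = back β
    ; back        = forth β
    ; termination = λ b → ⇔-sym (termination β b)
    }

  compose : ∀ {Z} {E : OneChart A Z} {B B′} →
            IsOneBisimulation C D B → IsOneBisimulation D E B′ →
            IsOneBisimulation C E (λ x z → ∃[ y ] (B x y × B′ y z))
  compose β β′ = record
    { onVertices  = λ (_ , b , b′) → proj₁ (onVertices β b) , proj₂ (onVertices β′ b′)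
    ; startRel    = _ , startRel β , startRel β′
    ; forth       = λ (_ , b , b′) i → let _ , j , r  = forth β b i
                                           _ , k , r′ = forth β′ b′ j
                                       in _ , k , _ , r , r′
    ; back        = λ (_ , b , b′) i → let _ , j , r′ = back β′ b′ i
                                           _ , k , r  = back β b j
                                       in _ , k , _ , r , r′
    ; termination = λ (_ , b , b′) → termination β′ b′ ⇔-∘ termination β b
    }

module _ {A X : Set} (C : OneChart A X) {w : X} {w∈V : V C w} (reach : ∀ p → Reachable C w p) where

  generated⁺ : ∀ {p l q} → Induced C p l q → Induced (generated C w w∈V) p l q
  generated⁺ (_ , ss , t) = _ , Star.map (reach _ ,_) ss , reach _ , t

  generated⁻ : ∀ {p l q} → Induced (generated C w w∈V) p l q → Induced C p l q
  generated⁻ (_ , ss , _ , t) = _ , Star.map proj₂ ss , t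

-- Sets of transitions that no elimination can touch

StepIn : TransitionSet A Y → Rel Y 0ℓ
StepIn G x y = ∃[ l ] G (x , l , y)

Unending : Rel Y 0ℓ → Pred Y 0ℓ → Set
Unending R Q = ∀ {x} → Q x → ∃[ y ] (R x y × Q y)

unending-path : {R : Rel Y 0ℓ} {Q : Pred Y 0ℓ} → Unending R Q → ∀ {x} → Q x →
                Σ[ p ∈ (ℕ → Y) ] (IsInfinitePath R p × p 0 ≡ x × (∀ i → Q (p i)))
unending-path {Y = Y} {R} {Q} next {x} qx =
  proj₁ ∘ walk , (λ i → proj₁ (proj₂ (next (proj₂ (walk i))))) , refl , proj₂ ∘ walk
  where
  walk : ℕ → Σ Y Q
  walk zero    = x , qx
  walk (suc n) = let y , _ , qy = next (proj₂ (walk n)) in y , qy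

-- `escape` is doubly negated because vertex sets carry no decision procedure; it is used only for
-- negative goals. `reachable` stays inside `G` so that `G` survives the restriction to the part
-- reachable from the start vertex.
record Persistent (s : Y) (G : TransitionSet A Y) : Set₁ where
  field
    inhabited : Satisfiable G
    reachable : ∀ {x l y} → G (x , l , y) → Star (StepIn G) s x
    escape    : ∀ {x l y} → G (x , l , y) →
                ¬ ¬ (Σ[ Q ∈ Pred Y 0ℓ ] (Q y × ¬ Q x × Unending (StepIn G) Q))

module _ {A Y : Set} {G : TransitionSet A Y} where

  open Persistent

  -- An entry transition `x → y` in `G` would begin an infinite path in the loop sub-chart that
  -- never returns to `x`, against (L2).
  eliminate-persistent : {C : OneChart A Y} → Persistent (start C) G → G ⊆ Trans[ C ] →
                         (S : LoopSubchart C) → G ⊆ Trans[ eliminate S ]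
  eliminate-persistent {C} pers G⊆C S {x , l , y} gt =
    Star.map (λ (l′ , g) → l′ , kept g) (reachable pers gt) , kept gt
    where
    open EntrySet (entries S) using (U-from-v)

    not-entry : ∀ {t} → G t → ¬ U S t
    not-entry {x , l , y} gt ut with U-from-v ut
    ... | refl = escape pers gt λ (Q , qy , ¬qx , next) →
      let
        avoiding : Unending (Step (loopSubchart (entries S)))
                            (λ q → Q q × Visited (entries S) q)
        avoiding (qq , vis) =
          let _ , (l′ , g) , qr = next qq
              q≢x               = λ q≡x → ¬qx (subst Q q≡x qq)
          in _ , (l′ , inj₂ (vis , q≢x , G⊆C g)) , qr , continue vis q≢x (G⊆C g)
        p , steps , p0≡y , inQ = unending-path avoiding (qy , enter ut)

        -- The entry transition is put in front, so that the path starts at the start vertex of the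
        -- loop, where (L2) applies.
        path : ℕ → Y
        path = λ { zero → x ; (suc n) → p n }

        path-steps : IsInfinitePath (Step (loopSubchart (entries S))) path
        path-steps = λ { zero    → l , inj₁ (subst (λ q → U S (x , l , q)) (sym p0≡y) ut)
                       ; (suc n) → steps n }

        n , pn≡x = IsLoopChart.L2 (isLoopChart S) path path-steps refl
      in ¬qx (subst Q pn≡x (proj₁ (inQ n)))

    kept : ∀ {t} → G t → Trans[ C ] t × ¬ U S t
    kept g = G⊆C g , not-entry g

  -- The last chart of any elimination process still contains `G`, and `G` contains an infinite
  -- path.
  persistent⇒¬LEE : {C : OneChart A Y} → Persistent (start C) G → G ⊆ Trans[ C ] → ¬ LEE C
  persistent⇒¬LEE pers G⊆C (_ , es , finite) = go pers G⊆C es finite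
    where
    go : ∀ {C C′ : OneChart A Y} → Persistent (start C) G → G ⊆ Trans[ C ] →
         Elimination C C′ → ¬ ¬ HasInfinitePath (Step C′)
    go pers G⊆C [] finite =
      let _ , gt = inhabited pers in
      escape pers gt λ (Q , qy , _ , next) →
        let p , steps , _ = unending-path next qy
        in finite (p , λ i → map₂ G⊆C (steps i))
    go pers G⊆C (S ∷ es) = go pers (eliminate-persistent pers G⊆C S) es

LLEE⇒LEE : {C : OneChart A X} → LLEE C → LEE C
LLEE⇒LEE (_ , es , _ , finite) = _ , es , finite

-- Paths of silent steps that end with a single transition

module _ {A Y : Set} (D : OneChart A Y) where

  -- Induced transitions, but with the last label also allowed to be `𝟏`, for paths that end with a
  -- silent step into a chosen vertex.
  Toward : Label A → Y → Pred Y 0ℓ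
  Toward l q x = ∃[ x′ ] (Star (OneStep D) x x′ × Trans[ D ] (x′ , l , q))

  data Path (P : Pred Y 0ℓ) (l : Label A) (q : Y) : Y → Set where
    final  : ∀ {x} → P x → Trans[ D ] (x , l , q) → Path P l q x
    silent : ∀ {x y} → P x → OneStep D x y → Path P l q y → Path P l q x

module _ {A Y : Set} {D : OneChart A Y} where

  -- Each vertex on the path is reached silently from `p`, so `p` enables all that it enables, and
  -- it still reaches the last transition itself. The avoidance arguments below rest on these two
  -- facts.
  enrich : ∀ {P l q p x} → Star (OneStep D) p x → Path D P l q x →
           Path D (λ y → P y × Star (OneStep D) p y × Toward D l q y) l q x
  enrich r π = proj₁ (go r π)
    where
    go : ∀ {P l q p x} → Star (OneStep D) p x → Path D P l q x →
         Path D (λ y → P y × Star (OneStep D) p y × Toward D l q y) l q x × Toward D l q x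
    go r (final px t)    = let τ = _ , ε , t in final (px , r , τ) t , τ
    go r (silent px s π) =
      let π′ , _ , ss , t = go (r ◅◅ s ◅ ε) π
          τ               = _ , s ◅ ss , t
      in silent (px , r , τ) s π′ , τ

  toPath : ∀ {l q x x′} → Star (OneStep D) x x′ → Trans[ D ] (x′ , l , q) →
           Path D (λ _ → ⊤) l q x
  toPath ε        t = final tt t
  toPath (s ◅ ss) t = silent tt s (toPath ss t)

  module _ {P : Pred Y 0ℓ} {l : Label A} {q : Y} where

    On : ∀ {x} → Path D P l q x → TransitionSet A Y
    On (final {x} _ _)        t = t ≡ (x , l , q)
    On (silent {x} {y} _ _ π) t = t ≡ (x , 𝟏 , y) ⊎ On π t

    Vertex : ∀ {x} → Path D P l q x → Pred Y 0ℓ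
    Vertex (final {x} _ _)    p = p ≡ x
    Vertex (silent {x} _ _ π) p = p ≡ x ⊎ Vertex π p

    Simple : ∀ {x} → Path D P l q x → Set
    Simple (final _ _)        = ⊤
    Simple (silent {x} _ _ π) = ¬ Vertex π x × Simple π

    initial : ∀ {x} (π : Path D P l q x) → Vertex π x
    initial (final _ _)    = refl
    initial (silent _ _ _) = inj₁ refl

    On⊆trans : ∀ {x} (π : Path D P l q x) → On π ⊆ Trans[ D ]
    On⊆trans (final _ t)    refl        = t
    On⊆trans (silent _ s _) (inj₁ refl) = s
    On⊆trans (silent _ _ π) (inj₂ o)    = On⊆trans π o

    Vertex⇒P : ∀ {x} (π : Path D P l q x) → Vertex π ⊆ P
    Vertex⇒P (final px _)    refl        = px
    Vertex⇒P (silent px _ _) (inj₁ refl) = px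
    Vertex⇒P (silent _ _ π)  (inj₂ o)    = Vertex⇒P π o

    source-Vertex : ∀ {x} (π : Path D P l q x) {p k r} → On π (p , k , r) → Vertex π p
    source-Vertex (final _ _)    refl        = refl
    source-Vertex (silent _ _ _) (inj₁ refl) = inj₁ refl
    source-Vertex (silent _ _ π) (inj₂ o)    = inj₂ (source-Vertex π o)

    Vertex⇒step : ∀ {x} (π : Path D P l q x) {p} → Vertex π p →
                  ∃[ r ] (StepIn (On π) p r × (r ≡ q ⊎ Vertex π r))
    Vertex⇒step (final _ _)    refl        = _ , (_ , refl) , inj₁ refl
    Vertex⇒step (silent _ _ π) (inj₁ refl) = _ , (_ , inj₁ refl) , inj₂ (inj₂ (initial π))
    Vertex⇒step (silent _ _ π) (inj₂ o) with Vertex⇒step π o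
    ... | _ , (_ , t) , inj₁ r≡q = _ , (_ , inj₂ t) , inj₁ r≡q
    ... | _ , (_ , t) , inj₂ o′  = _ , (_ , inj₂ t) , inj₂ (inj₂ o′)

    On-reachable : ∀ {x} (π : Path D P l q x) {p} → Vertex π p → Star (StepIn (On π)) x p
    On-reachable (final _ _)    refl        = ε
    On-reachable (silent _ _ _) (inj₁ refl) = ε
    On-reachable (silent _ _ π) (inj₂ o)    =
      (_ , inj₁ refl) ◅ Star.map (map₂ inj₂) (On-reachable π o)

    On-target : ∀ {x} (π : Path D P l q x) → Star (StepIn (On π)) x q
    On-target (final _ _)    = (_ , refl) ◅ ε
    On-target (silent _ _ π) = (_ , inj₁ refl) ◅ Star.map (map₂ inj₂) (On-target π)

    -- Simplicity keeps the remainder of the path away from `p`. This remainder is the first stretch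
    -- of the infinite path that avoids `p`.
    rest : ∀ {x} (π : Path D P l q x) → Simple π → ∀ {p k r} → On π (p , k , r) →
           r ≡ q ⊎ Σ[ π′ ∈ Path D P l q r ] (¬ Vertex π′ p × On π′ ⊆ On π)
    rest (final _ _)    _           refl        = inj₁ refl
    rest (silent _ _ π) (x∉π , _)   (inj₁ refl) = inj₂ (π , x∉π , inj₂)
    rest (silent _ _ π) (_ , simpl) (inj₂ o) with rest π simpl o
    ... | inj₁ r≡q             = inj₁ r≡q
    ... | inj₂ (π′ , p∉ , sub) = inj₂ (π′ , p∉ , inj₂ ∘ sub)

    Vertex? : ∀ {x} (π : Path D P l q x) → Decidable (Vertex π)
    Vertex? (final {x} _ _)    p = Finite⇒≟ (finite-X D) p x
    Vertex? (silent {x} _ _ π) p = Finite⇒≟ (finite-X D) p x ⊎-dec Vertex? π p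

    suffix : ∀ {x} (π : Path D P l q x) → Simple π → ∀ {p} → Vertex π p → Σ (Path D P l q p) Simple
    suffix π@(final _ _)    s       refl        = π , s
    suffix π@(silent _ _ _) s       (inj₁ refl) = π , s
    suffix (silent _ _ π)   (_ , s) (inj₂ o)    = suffix π s o

    -- If `x` occurs again on the shortened tail, the detour in between is dropped.
    shorten : ∀ {x} → Path D P l q x → Σ (Path D P l q x) Simple
    shorten (final px t) = final px t , tt
    shorten (silent {x} px s π) with shorten π
    ... | π′ , simple with Vertex? π′ x
    ...   | yes x∈π′ = suffix π′ simple x∈π′
    ...   | no  x∉π′ = silent px s π′ , x∉π′ , simple

-- Lassos in a graph of realised edges

-- P e over-approximates the vertices on the path that realises the edge e.
module Realised {A Y : Set} (D : OneChart A Y) {M : Set} (⟦_⟧ : M → Y)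
                (Edge : Rel M 0ℓ) (lab : ∀ {m n} → Edge m n → Label A)
                (P : ∀ {m n} → Edge m n → Pred Y 0ℓ) where

  Avoiding : Y → Rel M 0ℓ
  Avoiding x m n = Σ[ e ∈ Edge m n ] ¬ P e x

  -- A finite certificate for an infinite walk on edges that avoid `x`. The first edge of the cycle
  -- is singled out so that the cycle is not empty.
  Lasso : Y → Pred M 0ℓ
  Lasso x m = ∃[ n ] (Star (Avoiding x) m n × ∃[ k ] (Avoiding x n k × Star (Avoiding x) k n))

  infixr 5 _◅ᴸ_

  _◅ᴸ_ : ∀ {x m n} → Avoiding x m n → Lasso x n → Lasso x m
  e ◅ᴸ (n , stem , loop) = n , e ◅ stem , loop

  cycle : ∀ {x m n} → Avoiding x m n → Star (Avoiding x) n m → Lasso x m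
  cycle e es = _ , ε , _ , e , es

  zigzag : ∀ {x} (s t : Bool → M) → (∀ τ → Avoiding x (s τ) (t τ)) →
           (∀ τ → Avoiding x (t τ) (s (not τ))) → ∀ τ → Lasso x (s τ)
  zigzag _ _ st ts true  = cycle (st true)  (ts true  ◅ st false ◅ ts false ◅ ε)
  zigzag _ _ st ts false = cycle (st false) (ts false ◅ st true  ◅ ts true  ◅ ε)

  -- `G` consists of the transitions on simple paths that realise the edges. After a transition
  -- `x → y` on the path of `e`, the rest of that path avoids `x` by simplicity, and from its end a
  -- lasso avoiding `x` continues forever.
  lassos⇒¬LEE :
    (∀ {m n} (e : Edge m n) → Path D (P e) (lab e) ⟦ n ⟧ ⟦ m ⟧) →
    (∀ {m n} (e : Edge m n) {x} → P e x → ¬ ¬ Lasso x n) →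
    ∀ {m₀ m₁} → Edge m₀ m₁ → start D ≡ ⟦ m₀ ⟧ → (∀ {m n} → Edge m n → Star Edge m₀ m) → ¬ LEE D
  lassos⇒¬LEE path lasso e₀ start≡ connected =
    persistent⇒¬LEE {G = G}
      record { inhabited = _ , G-initial ; reachable = reachable ; escape = escape }
      (λ (_ , _ , e , o) → On⊆trans (path₁ e) o)
    where
    path₁ : ∀ {m n} (e : Edge m n) → Path D (P e) (lab e) ⟦ n ⟧ ⟦ m ⟧
    path₁ e = proj₁ (shorten (path e))

    G : TransitionSet A Y
    G t = ∃[ m ] ∃[ n ] Σ[ e ∈ Edge m n ] On (path₁ e) t

    inG : ∀ {m n} (e : Edge m n) {x y} → StepIn (On (path₁ e)) x y → StepIn G x y
    inG e (l , o) = l , _ , _ , e , o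

    G-initial : G _
    G-initial = _ , _ , e₀ , proj₂ (proj₁ (proj₂ (Vertex⇒step (path₁ e₀) (initial (path₁ e₀)))))

    between : ∀ {m n} → Star Edge m n → Star (StepIn G) ⟦ m ⟧ ⟦ n ⟧
    between = Star.kleisliStar ⟦_⟧ λ e → Star.map (inG e) (On-target (path₁ e))

    reachable : ∀ {x l y} → G (x , l , y) → Star (StepIn G) (start D) x
    reachable (_ , _ , e , o) rewrite start≡ =
      between (connected e) ◅◅
      Star.map (inG e) (On-reachable (path₁ e) (source-Vertex (path₁ e) o))

    escape : ∀ {x l y} → G (x , l , y) →
             ¬ ¬ (Σ[ Q ∈ Pred Y 0ℓ ] (Q y × ¬ Q x × Unending (StepIn G) Q))
    escape {x} {_} {y} (_ , n₀ , e , o) none =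
      lasso e (Vertex⇒P (path₁ e) (source-Vertex (path₁ e) o)) go
      where
      go : ¬ Lasso x n₀
      go (hub , stem , k , loop-first , loop-rest) =
        none (Q′ (rest (path₁ e) (proj₂ (shorten (path e))) o))
        where
        -- A route to the hub is kept at each vertex; this makes `Q` unending without recording a
        -- position on the lasso.
        Q : Pred Y 0ℓ
        Q p = ∃[ m ] ∃[ n ] Σ[ (e , _) ∈ Avoiding x m n ]
                (Star (Avoiding x) n hub × Vertex (path₁ e) p)

        at-node : ∀ {m} → Star (Avoiding x) m hub → Q ⟦ m ⟧
        at-node ε        = _ , _ , loop-first , loop-rest , initial (path₁ (proj₁ loop-first))
        at-node (e ◅ es) = _ , _ , e , es , initial (path₁ (proj₁ e))

        next : Unending (StepIn G) Q
        next (m , n , av@(e , _) , es , o) with Vertex⇒step (path₁ e) o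
        ... | _ , t , inj₁ refl = _ , inG e t , at-node es
        ... | _ , t , inj₂ o′   = _ , inG e t , m , n , av , es , o′

        ¬Qx : ¬ Q x
        ¬Qx (_ , _ , (e , ¬p) , _ , o) = ¬p (Vertex⇒P (path₁ e) o)

        Q′ : y ≡ ⟦ n₀ ⟧ ⊎ Σ[ π ∈ Path D (P e) (lab e) ⟦ n₀ ⟧ y ]
                (¬ Vertex π x × On π ⊆ On (path₁ e)) →
             Σ[ Q ∈ Pred Y 0ℓ ] (Q y × ¬ Q x × Unending (StepIn G) Q)
        Q′ (inj₁ refl)           = Q , at-node stem , ¬Qx , next
        Q′ (inj₂ (π , x∉π , π⊆)) =
          (λ p → Vertex π p ⊎ Q p) , inj₁ (initial π) ,
          (λ { (inj₁ o) → x∉π o ; (inj₂ q) → ¬Qx q }) , next′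
          where
          next′ : Unending (StepIn G) (λ p → Vertex π p ⊎ Q p)
          next′ (inj₂ q) = let r , g , q′ = next q in r , g , inj₂ q′
          next′ (inj₁ o) with Vertex⇒step π o
          ... | r , (l , t) , inj₁ refl = r , inG e (l , π⊆ t) , inj₂ (at-node stem)
          ... | r , (l , t) , inj₂ o′   = r , inG e (l , π⊆ t) , inj₁ o′

-- The configuration that rules out LEE

-- At true, V̂, X̂, Ô are the images of v, x₁, u, and at false those of w̄₁, y₁, z; Ŵ is the common
-- image of w₁ and w₂.
data Node : Set where
  V̂ X̂ Ô : Bool → Node
  Ŵ     : Node

data Lab : Set where
  α β γ δ : Bool → Lab

data Edge : Rel Node 0ℓ where
  vx : ∀ σ τ → Edge (V̂ σ) (X̂ τ)
  vo : ∀ σ → Edge (V̂ σ) (Ô σ)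
  ov : ∀ σ → Edge (Ô σ) (V̂ (not σ))
  xv : ∀ σ → Edge (X̂ σ) (V̂ σ)
  xw : ∀ σ → Edge (X̂ σ) Ŵ
  wo : ∀ σ → Edge Ŵ (Ô σ)

lab : ∀ {m n} → Edge m n → Lab
lab (vx _ τ) = α τ
lab (vo σ)   = β σ
lab (ov σ)   = δ σ
lab (xv σ)   = γ σ
lab (xw σ)   = γ σ
lab (wo σ)   = β σ

-- An upper bound on the labels that a node enables. `Ŵ` is the only node that permits both `β true`
-- and `β false`.
data Permits : Node → Lab → Set where
  vα : ∀ {σ τ} → Permits (V̂ σ) (α τ)
  vβ : ∀ {σ} → Permits (V̂ σ) (β σ)
  xγ : ∀ {σ} → Permits (X̂ σ) (γ σ)
  oδ : ∀ {σ} → Permits (Ô σ) (δ σ)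
  wα : ∀ {τ} → Permits Ŵ (α τ)
  wβ : ∀ {τ} → Permits Ŵ (β τ)

either-side : ∀ σ {Q : Bool → Set} → Q σ → Q (not σ) → ∀ τ → Q τ
either-side true  q q′ true  = q
either-side true  q q′ false = q′
either-side false q q′ true  = q′
either-side false q q′ false = q

V̂∌β-not : ∀ σ → ¬ Permits (V̂ σ) (β (not σ))
V̂∌β-not true  ()
V̂∌β-not false ()

V̂-not∌β : ∀ σ → ¬ Permits (V̂ (not σ)) (β σ)
V̂-not∌β true  ()
V̂-not∌β false ()

-- The start vertex is the image of `v` in a collapse, and the common image of `w₁` and `w₂` in a
-- joint minimization.
record Configuration {A Y : Set} (D : OneChart A Y) : Set where
  field
    ⟦_⟧     : Node → Y
    ℓ       : Lab → A
    induced : ∀ {m n} (e : Edge m n) → Induced D ⟦ m ⟧ (ℓ (lab e)) ⟦ n ⟧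
    permits : ∀ {m k} → Enables D ⟦ m ⟧ (ℓ k) → Permits m k
    start≡  : start D ≡ ⟦ V̂ true ⟧ ⊎ start D ≡ ⟦ Ŵ ⟧

module _ {A Y : Set} {D : OneChart A Y} (conf : Configuration D) where

  open Configuration conf

  forbids : ∀ {m k x} → ¬ Permits m k → Enables D x (ℓ k) → ¬ Star (OneStep D) ⟦ m ⟧ x
  forbids ∌k (_ , _ , ss , t) r = ∌k (permits (_ , _ , r ◅◅ ss , t))

  -- D need not be collapsed, so ⟦ V̂ σ ⟧ may have copies through which ⟦ Ŵ ⟧ mimics it.
  Like : Bool → Pred Y 0ℓ
  Like σ x = (∀ τ → Induced D x (ℓ (α τ)) ⟦ X̂ τ ⟧)
           × Induced D x (ℓ (β σ)) ⟦ Ô σ ⟧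
           × ¬ Enables D x (ℓ (β (not σ)))

  ¬Like-Ŵ : ∀ σ → ¬ Like σ ⟦ Ŵ ⟧
  ¬Like-Ŵ σ (_ , _ , ¬β) = ¬β (_ , induced (wo (not σ)))

  Unlike⊎FirstLike : Bool → Label A → Y → Pred Y 0ℓ
  Unlike⊎FirstLike σ l q x =
    Path D (λ p → ¬ Like σ p) l q x
    ⊎ ∃[ y ] (Like σ y × (x ≡ y ⊎ Path D (λ p → ¬ Like σ p) 𝟏 y x))

  -- Walk along the silent path and stop at the first like vertex. Likeness is not decidable, hence
  -- the double negation, which is harmless for refuting LEE.
  unlike⊎firstLike : ∀ σ {l q x x′} → Star (OneStep D) x x′ → Trans[ D ] (x′ , l , q) →
                     ¬ ¬ Unlike⊎FirstLike σ l q x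
  unlike⊎firstLike σ {x = x} ss t none = ¬¬-excluded-middle λ
    { (yes like) → none (inj₂ (x , like , inj₁ refl))
    ; (no unlike) → unlike-head unlike ss t none
    }
    where
    unlike-head : ∀ {l q x x′} → ¬ Like σ x → Star (OneStep D) x x′ → Trans[ D ] (x′ , l , q) →
                  ¬ ¬ Unlike⊎FirstLike σ l q x
    unlike-head unlike ε        t none = none (inj₁ (final unlike t))
    unlike-head unlike (s ◅ ss) t none = unlike⊎firstLike σ ss t λ
      { (inj₁ π)                      → none (inj₁ (silent unlike s π))
      ; (inj₂ (_ , like , inj₁ refl)) → none (inj₂ (_ , like , inj₂ (final unlike s)))
      ; (inj₂ (_ , like , inj₂ π))    → none (inj₂ (_ , like , inj₂ (silent unlike s π)))
      }

  ŵ-unlike⊎firstLike : ∀ σ →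
    ¬ ¬ (Path D (λ p → ¬ Like σ p) (act (ℓ (β σ))) ⟦ Ô σ ⟧ ⟦ Ŵ ⟧
         ⊎ ∃[ y ] (Like σ y × Path D (λ p → ¬ Like σ p) 𝟏 y ⟦ Ŵ ⟧))
  ŵ-unlike⊎firstLike σ none =
    let _ , ss , t = induced (wo σ) in
    unlike⊎firstLike σ ss t λ
      { (inj₁ π)                      → none (inj₁ π)
      ; (inj₂ (_ , like , inj₁ refl)) → ¬Like-Ŵ σ like
      ; (inj₂ (y , like , inj₂ π))    → none (inj₂ (y , like , π))
      }

  -- The case in which both β-steps of `Ŵ` avoid like vertices

  module AllUnlike
    (w-path : ∀ σ → Path D (λ p → ¬ Like σ p) (act (ℓ (β σ))) ⟦ Ô σ ⟧ ⟦ Ŵ ⟧) where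

    Extra : ∀ {m n} → Edge m n → Pred Y 0ℓ
    Extra (wo σ) x = ¬ Like σ x
    Extra _      _ = ⊤

    P : ∀ {m n} → Edge m n → Pred Y 0ℓ
    P {m} {n} e x =
      Extra e x × Star (OneStep D) ⟦ m ⟧ x × Toward D (act (ℓ (lab e))) ⟦ n ⟧ x

    open Realised D ⟦_⟧ Edge (λ e → act (ℓ (lab e))) P

    path : ∀ {m n} (e : Edge m n) → Path D (P e) (act (ℓ (lab e))) ⟦ n ⟧ ⟦ m ⟧
    path e = enrich ε (path₀ e)
      where
      path₀ : ∀ {m n} (e : Edge m n) → Path D (Extra e) (act (ℓ (lab e))) ⟦ n ⟧ ⟦ m ⟧
      path₀ e@(vx _ _) = let _ , ss , t = induced e in toPath ss t
      path₀ e@(vo _)   = let _ , ss , t = induced e in toPath ss t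
      path₀ e@(ov _)   = let _ , ss , t = induced e in toPath ss t
      path₀ e@(xv _)   = let _ , ss , t = induced e in toPath ss t
      path₀ e@(xw _)   = let _ , ss , t = induced e in toPath ss t
      path₀ (wo σ)     = w-path σ

    -- The vertices on the path of `e` are silently reachable from its source, so they enable only
    -- labels that `m` permits.
    av : ∀ {m n k x} (e : Edge m n) → ¬ Permits m k → Enables D x (ℓ k) → Avoiding x m n
    av e ∌k en = e , λ (_ , r , _) → forbids ∌k en r

    lacks : ∀ {m n x} (e : Edge m n) → ¬ Toward D (act (ℓ (lab e))) ⟦ n ⟧ x → Avoiding x m n
    lacks e ¬τ = e , λ (_ , _ , τ) → ¬τ τ

    -- Neither `V̂` nor `Ô` permits a label `γ τ`, so the cycle through both sides of `V̂` and `Ô`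
    -- misses `x`.
    γ-lasso : ∀ {x τ} → Enables D x (ℓ (γ τ)) → ∀ σ → Lasso x (V̂ σ)
    γ-lasso en = zigzag V̂ Ô (λ τ → av (vo τ) (λ ()) en) (λ τ → av (ov τ) (λ ()) en)

    vx-lasso : ∀ {x k} → Enables D x (ℓ k) → ∀ σ → ¬ Permits (V̂ σ) k → ¬ Permits (X̂ σ) k →
               Lasso x (V̂ σ)
    vx-lasso en σ v∌ x∌ = cycle (av (vx σ σ) v∌ en) (av (xv σ) x∌ en ◅ ε)

    data FromV (σ : Bool) : Node → Set where
      toX : ∀ τ → FromV σ (X̂ τ)
      toO : FromV σ (Ô σ)

    -- Enabling `β σ` excludes `x` from the paths that start at `X̂`, `Ô` or `V̂ (not σ)`, and the
    -- path of `wo σ` was chosen free of like vertices. The cycle runs through `V̂ (not σ)`,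
    -- `X̂ (not σ)`, `Ŵ` and `Ô σ`.
    like-lasso : ∀ {σ x} → Like σ x → ∀ {n} → FromV σ n → Lasso x n
    like-lasso {σ} {x} like@(_ , b , _) = λ
      { (toX τ) → xw′ τ ◅ᴸ wo′ ◅ᴸ ov′ ◅ᴸ from-V̂
      ; toO     → ov′ ◅ᴸ from-V̂
      }
      where
      wo′ : Avoiding x Ŵ (Ô σ)
      wo′ = wo σ , λ (unlike , _) → unlike like

      xw′ : ∀ τ → Avoiding x (X̂ τ) Ŵ
      xw′ τ = av (xw τ) (λ ()) (_ , b)

      ov′ : Avoiding x (Ô σ) (V̂ (not σ))
      ov′ = av (ov σ) (λ ()) (_ , b)

      from-V̂ : Lasso x (V̂ (not σ))
      from-V̂ = cycle (av (vx (not σ) (not σ)) (V̂-not∌β σ) (_ , b)) (xw′ (not σ) ◅ wo′ ◅ ov′ ◅ ε)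

    module _ {σ : Bool} {x : Y} (¬β : ¬ Enables D x (ℓ (β (not σ))))
             (xv′ : ∀ τ → Avoiding x (X̂ τ) (V̂ τ))
             (ov′ : ∀ τ → Avoiding x (Ô τ) (V̂ (not τ))) where

      private
        vo-not : Avoiding x (V̂ (not σ)) (Ô (not σ))
        vo-not = lacks (vo (not σ)) λ t → ¬β (_ , t)

      lacksβ-lasso : ¬ Induced D x (ℓ (β σ)) ⟦ Ô σ ⟧ → ∀ {n} → FromV σ n → Lasso x n
      lacksβ-lasso ¬b = λ
        { (toX τ) → xv′ τ ◅ᴸ zigzag V̂ Ô vo′ ov′ τ
        ; toO     → ov′ σ ◅ᴸ zigzag V̂ Ô vo′ ov′ (not σ)
        }
        where
        vo′ : ∀ τ → Avoiding x (V̂ τ) (Ô τ)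
        vo′ = either-side σ (lacks (vo σ) ¬b) vo-not

      -- The missing `α ρ`-step makes `vx σ ρ` avoid `x`. If `ρ` equals `σ`, this edge closes a
      -- cycle with `xv`; otherwise the cycle crosses to the other side at `X̂ ρ` and comes back
      -- through `Ô ρ`.
      lacksα-lasso : ∀ {ρ} → ¬ Induced D x (ℓ (α ρ)) ⟦ X̂ ρ ⟧ → ∀ {n} → FromV σ n → Lasso x n
      lacksα-lasso {ρ} ¬a = λ
        { (toX τ) → xv′ τ ◅ᴸ from-V̂ τ
        ; toO     → ov′ σ ◅ᴸ from-V̂ (not σ)
        }
        where
        loop : ∀ σ ρ → Avoiding x (V̂ σ) (X̂ ρ) → Avoiding x (V̂ (not σ)) (Ô (not σ)) →
               ∀ τ → Lasso x (V̂ τ)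
        loop true  true  vx′ vo′ true  = cycle vx′ (xv′ true ◅ ε)
        loop true  true  vx′ vo′ false = vo′ ◅ᴸ ov′ false ◅ᴸ cycle vx′ (xv′ true ◅ ε)
        loop true  false vx′ vo′ true  = cycle vx′ (xv′ false ◅ vo′ ◅ ov′ false ◅ ε)
        loop true  false vx′ vo′ false = cycle vo′ (ov′ false ◅ vx′ ◅ xv′ false ◅ ε)
        loop false true  vx′ vo′ true  = cycle vo′ (ov′ true ◅ vx′ ◅ xv′ true ◅ ε)
        loop false true  vx′ vo′ false = cycle vx′ (xv′ true ◅ vo′ ◅ ov′ true ◅ ε)
        loop false false vx′ vo′ true  = vo′ ◅ᴸ ov′ true ◅ᴸ cycle vx′ (xv′ false ◅ ε)
        loop false false vx′ vo′ false = cycle vx′ (xv′ false ◅ ε)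

        from-V̂ : ∀ τ → Lasso x (V̂ τ)
        from-V̂ = loop σ ρ (lacks (vx σ ρ) ¬a) vo-not

    -- Lying behind `V̂ σ`, the vertex `x` does not enable `β (not σ)`. So either it lacks a
    -- transition demanded by `Like σ`, which frees an edge out of `V̂ σ`, or it is like.
    fromV-lasso : ∀ {σ x} → Star (OneStep D) ⟦ V̂ σ ⟧ x →
                  (∀ τ → Avoiding x (X̂ τ) (V̂ τ)) → (∀ τ → Avoiding x (Ô τ) (V̂ (not τ))) →
                  ∀ {n} → FromV σ n → ¬ ¬ Lasso x n
    fromV-lasso {σ} {x} r xv′ ov′ n none =
      ¬¬-excluded-middle λ
        { (no ¬b) → none (lacksβ-lasso ¬β xv′ ov′ ¬b n)
        ; (yes b) → ¬¬-excluded-middle λ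
          { (no ¬a) → none (lacksα-lasso ¬β xv′ ov′ ¬a n)
          ; (yes aₜ) → ¬¬-excluded-middle λ
            { (no ¬c) → none (lacksα-lasso ¬β xv′ ov′ ¬c n)
            ; (yes cₜ) → none (like-lasso ((λ { true → aₜ ; false → cₜ }) , b , ¬β) n)
            }
          }
        }
      where
      ¬β : ¬ Enables D x (ℓ (β (not σ)))
      ¬β en = forbids (V̂∌β-not σ) en r

    lasso : ∀ {m n} (e : Edge m n) {x} → P e x → ¬ ¬ Lasso x n
    lasso (vx σ τ) (_ , r , t) =
      fromV-lasso r (λ τ → av (xv τ) (λ ()) (_ , t)) (λ τ → av (ov τ) (λ ()) (_ , t)) (toX τ)
    lasso (vo σ)   (_ , r , t) =
      fromV-lasso r (λ τ → av (xv τ) (λ ()) (_ , t)) (λ τ → av (ov τ) (λ ()) (_ , t)) toO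
    lasso (ov σ)   (_ , _ , t) none = none (vx-lasso (_ , t) (not σ) (λ ()) (λ ()))
    lasso (xv σ)   (_ , _ , t) none = none (γ-lasso (_ , t) σ)
    lasso (xw σ)   (_ , _ , t) none = none
      (av (wo true) (λ ()) (_ , t) ◅ᴸ av (ov true) (λ ()) (_ , t) ◅ᴸ γ-lasso (_ , t) false)
    lasso (wo σ)   (_ , _ , t) none = none
      (av (ov σ) (λ ()) (_ , t) ◅ᴸ vx-lasso (_ , t) (not σ) (V̂-not∌β σ) (λ ()))

    from-V̂ : ∀ m → Star Edge (V̂ true) m
    from-V̂ (V̂ true)  = ε
    from-V̂ (V̂ false) = vo true ◅ ov true ◅ ε
    from-V̂ (X̂ τ)     = vx true τ ◅ ε
    from-V̂ (Ô true)  = vo true ◅ ε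
    from-V̂ (Ô false) = vo true ◅ ov true ◅ vo false ◅ ε
    from-V̂ Ŵ         = vx true true ◅ xw true ◅ ε

    ¬LEE : ¬ LEE D
    ¬LEE with start≡
    ... | inj₁ s≡v = lassos⇒¬LEE path lasso (vo true) s≡v (λ {m} _ → from-V̂ m)
    ... | inj₂ s≡w = lassos⇒¬LEE path lasso (wo true) s≡w
                       (λ {m} _ → wo false ◅ ov false ◅ from-V̂ m)

  -- The case in which a β-step of `Ŵ` passes through a like vertex

  module SomeLike (ρ : Bool) {v′ : Y} (like : Like ρ v′)
                  (w-path : Path D (λ p → ¬ Like ρ p) 𝟏 v′ ⟦ Ŵ ⟧) where

    private
      ρ′ : Bool
      ρ′ = not ρ

    -- All edges at `X̂ ρ` are dropped, and so are the direct edges out of `Ŵ`, which is left only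
    -- through `v′`.
    data Kept : ∀ {m n} → Edge m n → Set where
      kvx : ∀ σ → Kept (vx σ ρ′)
      kvo : ∀ σ → Kept (vo σ)
      kov : ∀ σ → Kept (ov σ)
      kxv : Kept (xv ρ′)
      kxw : Kept (xw ρ′)

    -- nothing stands for v′.
    data Edge′ : Rel (Maybe Node) 0ℓ where
      keep  : ∀ {m n} {e : Edge m n} → Kept e → Edge′ (just m) (just n)
      enter : Edge′ (just Ŵ) nothing
      vx′   : Edge′ nothing (just (X̂ ρ′))
      vo′   : Edge′ nothing (just (Ô ρ))

    ⟦_⟧′ : Maybe Node → Y
    ⟦ just m ⟧′  = ⟦ m ⟧
    ⟦ nothing ⟧′ = v′

    lab′ : ∀ {m n} → Edge′ m n → Label A
    lab′ (keep {e = e} _) = act (ℓ (lab e))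
    lab′ enter            = 𝟏
    lab′ vx′              = act (ℓ (α ρ′))
    lab′ vo′              = act (ℓ (β ρ))

    Extra : ∀ {m n} → Edge′ m n → Pred Y 0ℓ
    Extra enter x = ¬ Like ρ x
    Extra _     _ = ⊤

    P : ∀ {m n} → Edge′ m n → Pred Y 0ℓ
    P {m} {n} e x = Extra e x × Star (OneStep D) ⟦ m ⟧′ x × Toward D (lab′ e) ⟦ n ⟧′ x

    open Realised D ⟦_⟧′ Edge′ lab′ P

    path : ∀ {m n} (e : Edge′ m n) → Path D (P e) (lab′ e) ⟦ n ⟧′ ⟦ m ⟧′
    path e = enrich ε (path₀ e)
      where
      path₀ : ∀ {m n} (e : Edge′ m n) → Path D (Extra e) (lab′ e) ⟦ n ⟧′ ⟦ m ⟧′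
      path₀ (keep {e = e} _) = let _ , ss , t = induced e in toPath ss t
      path₀ enter            = w-path
      path₀ vx′              = let _ , ss , t = proj₁ like ρ′ in toPath ss t
      path₀ vo′              = let _ , ss , t = proj₁ (proj₂ like) in toPath ss t

    w→v′ : Star (OneStep D) ⟦ Ŵ ⟧ v′
    w→v′ = let _ , _ , _ , ss , s = Vertex⇒P (path enter) (initial (path enter)) in ss ◅◅ s ◅ ε

    av : ∀ {m n l x} (e : Edge′ m n) → ¬ Enables D ⟦ m ⟧′ l → Enables D x l → Avoiding x m n
    av e ∌l (_ , _ , ss , t) = e , λ (_ , r , _) → ∌l (_ , _ , r ◅◅ ss , t)

    keep-av : ∀ {m n k x} {e : Edge m n} → Kept e → ¬ Permits m k → Enables D x (ℓ k) →
              Avoiding x (just m) (just n)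
    keep-av κ ∌k = av (keep κ) (∌k ∘ permits)

    v′∌γ : ∀ {τ} → ¬ Enables D v′ (ℓ (γ τ))
    v′∌γ en = forbids (λ ()) en w→v′

    v′∌β : ¬ Enables D v′ (ℓ (β ρ′))
    v′∌β = proj₂ (proj₂ like)

    before-v′ : ∀ {l q x} → Toward D 𝟏 v′ x → Induced D v′ l q → Induced D x l q
    before-v′ (_ , ss , s) (_ , ss′ , t) = _ , ss ◅◅ s ◅ ss′ , t

    lacks-vo : ∀ {x} → ¬ Enables D x (ℓ (β ρ)) → ¬ Enables D x (ℓ (β ρ′)) →
               ∀ τ → Avoiding x (just (V̂ τ)) (just (Ô τ))
    lacks-vo ¬β ¬β′ τ = keep (kvo τ) , λ (_ , _ , t) →
      either-side ρ {λ σ → ¬ Enables D _ (ℓ (β σ))} ¬β ¬β′ τ (_ , t)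

    x-lasso : ∀ {x k} → Enables D x (ℓ k) → ¬ Permits (V̂ ρ′) k → ¬ Permits (X̂ ρ′) k →
              Lasso x (just (X̂ ρ′))
    x-lasso en v∌ x∌ = keep-av kxv x∌ en ◅ᴸ cycle (keep-av (kvx ρ′) v∌ en) (keep-av kxv x∌ en ◅ ε)

    -- On the cycle through `X̂ ρ′`, `Ŵ` and `v′`: a vertex on the path into `v′` would inherit
    -- `β ρ` from `v′`, while `X̂ ρ′` and `v′` do not enable `β ρ′`.
    w-lasso : ∀ {x} → ¬ Enables D x (ℓ (β ρ)) → Enables D x (ℓ (β ρ′)) → Lasso x (just (X̂ ρ′))
    w-lasso {x} ¬β en = cycle (keep-av kxw (λ ()) en) (enter′ ◅ av vx′ v′∌β en ◅ ε)
      where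
      enter′ : Avoiding x (just Ŵ) nothing
      enter′ = enter , λ (_ , _ , τ) → ¬β (_ , before-v′ τ (proj₁ (proj₂ like)))

    core-lasso : ∀ {x k} → (∀ τ → Avoiding x (just (V̂ τ)) (just (Ô τ))) → Enables D x (ℓ k) →
                 (∀ {τ} → ¬ Permits (Ô τ) k) → ∀ τ → Lasso x (just (V̂ τ))
    core-lasso vo″ en o∌ =
      zigzag (just ∘ V̂) (just ∘ Ô) vo″ (λ τ → keep-av (kov τ) o∌ en)

    -- Enabling `β ρ` keeps `x` off the paths from `V̂ ρ′`; enabling only `β ρ′` keeps it off the
    -- cycle through `v′`; enabling neither keeps it off all paths from `V̂ τ` to `Ô τ`.
    α-lasso : ∀ {x τ} → Enables D x (ℓ (α τ)) → ¬ ¬ Lasso x (just (X̂ ρ′))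
    α-lasso en none = ¬¬-excluded-middle λ
      { (yes b) → none (x-lasso b (V̂-not∌β ρ) (λ ()))
      ; (no ¬β) → ¬¬-excluded-middle λ
        { (yes b′) → none (w-lasso ¬β b′)
        ; (no ¬β′) → none (keep-av kxv (λ ()) en ◅ᴸ core-lasso (lacks-vo ¬β ¬β′) en (λ ()) ρ′)
        }
      }

    γ-lasso : ∀ {x τ} → Enables D x (ℓ (γ τ)) → ∀ σ → Lasso x (just (V̂ σ))
    γ-lasso en = core-lasso (λ τ → keep-av (kvo τ) (λ ()) en) en (λ ())

    β-lasso : ∀ {x} → Enables D x (ℓ (β ρ)) → Lasso x (just (Ô ρ))
    β-lasso en = keep-av (kov ρ) (λ ()) en ◅ᴸ keep-av (kvx ρ′) (V̂-not∌β ρ) en ◅ᴸ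
                 x-lasso en (V̂-not∌β ρ) (λ ())

    vo-lasso : ∀ {σ x} → σ ≡ ρ ⊎ σ ≡ ρ′ → Star (OneStep D) ⟦ V̂ σ ⟧ x → Enables D x (ℓ (β σ)) →
               Lasso x (just (Ô σ))
    vo-lasso (inj₁ refl) _ en = β-lasso en
    vo-lasso (inj₂ refl) r en =
      keep-av (kov ρ′) (λ ()) en ◅ᴸ keep-av (kvx (not ρ′)) (V̂-not∌β ρ′) en ◅ᴸ
      -- As `x` lies behind `V̂ ρ′`, it cannot enable `β ρ`.
      w-lasso (λ b → forbids (V̂-not∌β ρ) b r) en

    lasso : ∀ {m n} (e : Edge′ m n) {x} → P e x → ¬ ¬ Lasso x n
    lasso (keep (kvx σ)) (_ , _ , t)    = α-lasso (_ , t)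
    lasso vx′            (_ , _ , t)    = α-lasso (_ , t)
    lasso vo′            (_ , _ , t) none = none (β-lasso (_ , t))
    lasso (keep (kvo σ)) (_ , r , t) none = none
      (vo-lasso (either-side ρ {λ σ → σ ≡ ρ ⊎ σ ≡ ρ′} (inj₁ refl) (inj₂ refl) σ) r (_ , t))
    lasso (keep (kov σ)) (_ , _ , t) none = none
      (keep-av (kvx (not σ)) (λ ()) (_ , t) ◅ᴸ x-lasso (_ , t) (λ ()) (λ ()))
    lasso (keep kxv)     (_ , _ , t) none = none (γ-lasso (_ , t) ρ′)
    lasso (keep kxw)     (_ , _ , t) none = none
      (av enter (λ en → forbids (λ ()) en ε) (_ , t) ◅ᴸ av vo′ v′∌γ (_ , t) ◅ᴸ
       keep-av (kov ρ) (λ ()) (_ , t) ◅ᴸ γ-lasso (_ , t) ρ′)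
    -- From `v′` the vertex `x` inherits every transition that `Like ρ` demands. Being unlike, it
    -- must enable `β ρ′`, which `v′` does not.
    lasso enter          (unlike , _ , τ) none =
      let b = before-v′ τ (proj₁ (proj₂ like)) in
      unlike ((λ σ → before-v′ τ (proj₁ like σ)) , b , λ b′ →
        none (av vx′ v′∌β b′ ◅ᴸ x-lasso (_ , b) (V̂-not∌β ρ) (λ ())))

    to-V̂ : ∀ σ → Star Edge′ (just (V̂ true)) (just (V̂ σ))
    to-V̂ true  = ε
    to-V̂ false = keep (kvo true) ◅ keep (kov true) ◅ ε

    to-Ŵ : Star Edge′ (just (V̂ true)) (just Ŵ)
    to-Ŵ = keep (kvx true) ◅ keep kxw ◅ ε

    to-source : ∀ {m n} → Edge′ m n → Star Edge′ (just (V̂ true)) m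
    to-source (keep (kvx σ)) = to-V̂ σ
    to-source (keep (kvo σ)) = to-V̂ σ
    to-source (keep (kov σ)) = to-V̂ σ ◅◅ keep (kvo σ) ◅ ε
    to-source (keep kxv)     = keep (kvx true) ◅ ε
    to-source (keep kxw)     = keep (kvx true) ◅ ε
    to-source enter          = to-Ŵ
    to-source vx′            = to-Ŵ ◅◅ enter ◅ ε
    to-source vo′            = to-Ŵ ◅◅ enter ◅ ε

    Ŵ→V̂ : ∀ σ → Star Edge′ (just (V̂ (not σ))) (just (V̂ true))
    Ŵ→V̂ true  = keep (kvo false) ◅ keep (kov false) ◅ ε
    Ŵ→V̂ false = ε

    ¬LEE : ¬ LEE D
    ¬LEE with start≡
    ... | inj₁ s≡v = lassos⇒¬LEE path lasso (keep (kvo true)) s≡v to-source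
    ... | inj₂ s≡w = lassos⇒¬LEE path lasso enter s≡w
                       (λ e → enter ◅ vo′ ◅ keep (kov ρ) ◅ Ŵ→V̂ ρ ◅◅ to-source e)

  configuration⇒¬LEE : ¬ LEE D
  configuration⇒¬LEE lee =
    ŵ-unlike⊎firstLike true λ
      { (inj₂ (_ , like , π)) → SomeLike.¬LEE true like π lee
      ; (inj₁ π)              → ŵ-unlike⊎firstLike false λ
        { (inj₂ (_ , like , π′)) → SomeLike.¬LEE false like π′ lee
        ; (inj₁ π′)              → AllUnlike.¬LEE (λ { true → π ; false → π′ }) lee
        }
      }

-- The chart 𝒞

module Witness {A : Set} (finite-A : Finite A) (a b c d e f a₁ a₂ c₁ c₂ : A)
  (distinct : Unique (a ∷ b ∷ c ∷ d ∷ e ∷ f ∷ a₁ ∷ a₂ ∷ c₁ ∷ c₂ ∷ [])) where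

  open Counterexample finite-A a b c d e f a₁ a₂ c₁ c₂

  labels : List A
  labels = a ∷ b ∷ c ∷ d ∷ e ∷ f ∷ a₁ ∷ a₂ ∷ c₁ ∷ c₂ ∷ []

  distinct-labels : ∀ {i j} → i ≢ j → lookup labels i ≢ lookup labels j
  distinct-labels i≢j = i≢j ∘ lookup-injective distinct

  index : Lab → Fin 10
  index (α true)  = 0F
  index (β true)  = 1F
  index (α false) = 2F
  index (β false) = 3F
  index (δ false) = 4F
  index (δ true)  = 5F
  index (γ true)  = 6F
  index (γ false) = 8F

  -- Positions 7 and 9 hold `a₂` and `c₂`, which label no edge of the configuration.
  index⁻¹ : Fin 10 → Maybe Lab
  index⁻¹ 0F = just (α true)
  index⁻¹ 1F = just (β true)
  index⁻¹ 2F = just (α false)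
  index⁻¹ 3F = just (β false)
  index⁻¹ 4F = just (δ false)
  index⁻¹ 5F = just (δ true)
  index⁻¹ 6F = just (γ true)
  index⁻¹ 7F = nothing
  index⁻¹ 8F = just (γ false)
  index⁻¹ 9F = nothing

  index⁻¹∘index : ∀ k → index⁻¹ (index k) ≡ just k
  index⁻¹∘index (α true)  = refl
  index⁻¹∘index (α false) = refl
  index⁻¹∘index (β true)  = refl
  index⁻¹∘index (β false) = refl
  index⁻¹∘index (γ true)  = refl
  index⁻¹∘index (γ false) = refl
  index⁻¹∘index (δ true)  = refl
  index⁻¹∘index (δ false) = refl

  ℓ : Lab → A
  ℓ k = lookup labels (index k)

  ℓ-injective : ∀ {k k′} → ℓ k ≡ ℓ k′ → k ≡ k′
  ℓ-injective {k} {k′} eq = just-injective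
    (trans (sym (index⁻¹∘index k))
      (trans (cong index⁻¹ (lookup-injective distinct eq)) (index⁻¹∘index k′)))

  vtx : Node → Vtx
  vtx (V̂ true)  = v
  vtx (V̂ false) = w̄₁
  vtx (X̂ true)  = x₁
  vtx (X̂ false) = y₁
  vtx (Ô true)  = u
  vtx (Ô false) = z
  vtx Ŵ         = w₁

  permitted : ∀ m {l} → Enables 𝒞 (vtx m) l → ∃[ k ] (l ≡ ℓ k × Permits m k)
  permitted (V̂ true)  (_ , _ , ε , v-x₁)  = α true  , refl , vα
  permitted (V̂ true)  (_ , _ , ε , v-x₂)  = α true  , refl , vα
  permitted (V̂ true)  (_ , _ , ε , v-y₁)  = α false , refl , vα
  permitted (V̂ true)  (_ , _ , ε , v-y₂)  = α false , refl , vα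
  permitted (V̂ true)  (_ , _ , ε , v-u)   = β true  , refl , vβ
  permitted (V̂ false) (_ , _ , ε , w̄₁-x₁) = α true  , refl , vα
  permitted (V̂ false) (_ , _ , ε , w̄₁-x₂) = α true  , refl , vα
  permitted (V̂ false) (_ , _ , ε , w̄₁-y₁) = α false , refl , vα
  permitted (V̂ false) (_ , _ , ε , w̄₁-y₂) = α false , refl , vα
  permitted (V̂ false) (_ , _ , ε , w̄₁-z)  = β false , refl , vβ
  permitted (X̂ true)  (_ , _ , ε , x₁-w₂) = γ true  , refl , xγ
  permitted (X̂ true)  (_ , _ , ε , x₁-v)  = γ true  , refl , xγ
  permitted (X̂ false) (_ , _ , ε , y₁-w₁) = γ false , refl , xγ
  permitted (X̂ false) (_ , _ , ε , y₁-w̄₁) = γ false , refl , xγ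
  permitted (Ô true)  (_ , _ , ε , u-w̄₁)  = δ true  , refl , oδ
  permitted (Ô false) (_ , _ , ε , z-v)   = δ false , refl , oδ
  permitted Ŵ         (_ , _ , ε , w₁-u)  = β true  , refl , wβ
  permitted Ŵ         (_ , _ , w₁-w̄₁ ◅ ε , w̄₁-x₁) = α true  , refl , wα
  permitted Ŵ         (_ , _ , w₁-w̄₁ ◅ ε , w̄₁-x₂) = α true  , refl , wα
  permitted Ŵ         (_ , _ , w₁-w̄₁ ◅ ε , w̄₁-y₁) = α false , refl , wα
  permitted Ŵ         (_ , _ , w₁-w̄₁ ◅ ε , w̄₁-y₂) = α false , refl , wα
  permitted Ŵ         (_ , _ , w₁-w̄₁ ◅ ε , w̄₁-z)  = β false , refl , wβ
  permitted Ŵ         (_ , _ , w₁-w̄₁ ◅ () ◅ _ , _)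
  permitted (V̂ true)  (_ , _ , () ◅ _ , _)
  permitted (V̂ false) (_ , _ , () ◅ _ , _)
  permitted (X̂ true)  (_ , _ , () ◅ _ , _)
  permitted (X̂ false) (_ , _ , () ◅ _ , _)
  permitted (Ô true)  (_ , _ , () ◅ _ , _)
  permitted (Ô false) (_ , _ , () ◅ _ , _)

  proper : ∀ {p l q} → Trans (p , act l , q) → Induced 𝒞 p l q
  proper t = _ , ε , t

  -- Configurations from functional images of `𝒞`

  module Image {Y : Set} (D : OneChart A Y) (F : REL Vtx Y 0ℓ)
    (functional : ∀ {p y y′} → F p y → F p y′ → y ≡ y′)
    (forth : ∀ {p l q y} → F p y → Induced 𝒞 p l q → ∃[ y′ ] (Induced D y l y′ × F q y′))
    (back : ∀ {p l y y′} → F p y → Induced D y l y′ → ∃[ q ] (Induced 𝒞 p l q × F q y′))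
    {v̂ ŵ : Y} (Fv : F v v̂) (Fw₁ : F w₁ ŵ)
    (x₁→w : ∀ {y} → F x₁ y → Induced D y a₁ ŵ)
    (start≡ : start D ≡ v̂ ⊎ start D ≡ ŵ) where

    image-step : ∀ {p l q} → Trans (p , act l , q) → ∃ (F p) → ∃ (F q)
    image-step t (_ , Fp) = map₂ proj₂ (forth Fp (proper t))

    image-u : ∃ (F u)
    image-u = image-step v-u (_ , Fv)

    image-w̄₁ : ∃ (F w̄₁)
    image-w̄₁ = image-step u-w̄₁ image-u

    image : ∀ m → ∃ (F (vtx m))
    image (V̂ true)  = _ , Fv
    image (V̂ false) = image-w̄₁
    image (X̂ true)  = image-step v-x₁ (_ , Fv)
    image (X̂ false) = image-step v-y₁ (_ , Fv)
    image (Ô true)  = image-u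
    image (Ô false) = image-step w̄₁-z image-w̄₁
    image Ŵ         = _ , Fw₁

    transfer : ∀ m n {l} → Induced 𝒞 (vtx m) l (vtx n) →
               Induced D (proj₁ (image m)) l (proj₁ (image n))
    transfer m n i with forth (proj₂ (image m)) i
    ... | _ , j , Fn rewrite functional (proj₂ (image n)) Fn = j

    induced : ∀ {m n} (e : Edge m n) →
              Induced D (proj₁ (image m)) (ℓ (lab e)) (proj₁ (image n))
    induced (vx true true)   = transfer _ (X̂ true) (proper v-x₁)
    induced (vx true false)  = transfer _ (X̂ false) (proper v-y₁)
    induced (vx false true)  = transfer _ (X̂ true) (proper w̄₁-x₁)
    induced (vx false false) = transfer _ (X̂ false) (proper w̄₁-y₁)
    induced (vo true)        = transfer _ (Ô true) (proper v-u)
    induced (vo false)       = transfer _ (Ô false) (proper w̄₁-z)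
    induced (ov true)        = transfer _ (V̂ false) (proper u-w̄₁)
    induced (ov false)       = transfer _ (V̂ true) (proper z-v)
    induced (xv true)        = transfer _ (V̂ true) (proper x₁-v)
    induced (xv false)       = transfer _ (V̂ false) (proper y₁-w̄₁)
    -- In `𝒞` this step leads from `x₁` to `w₂`, not to `w₁`; `x₁→w` expresses that both have the
    -- same image.
    induced (xw true)        = x₁→w (proj₂ (image (X̂ true)))
    induced (xw false)       = transfer _ Ŵ (proper y₁-w₁)
    induced (wo true)        = transfer _ (Ô true) (proper w₁-u)
    induced (wo false)       = transfer _ (Ô false) (_ , w₁-w̄₁ ◅ ε , w̄₁-z)

    permits : ∀ {m k} → Enables D (proj₁ (image m)) (ℓ k) → Permits m k
    permits {m} (_ , i) with permitted m (map₂ proj₁ (back (proj₂ (image m)) i))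
    ... | _ , ℓk≡ , p = subst (Permits m) (sym (ℓ-injective ℓk≡)) p

    ¬LEE : ¬ LEE D
    ¬LEE = configuration⇒¬LEE record
      { ⟦_⟧ = proj₁ ∘ image ; ℓ = ℓ ; induced = induced ; permits = permits ; start≡ = start≡ }

  -- The layering of `𝒞`

  -- Entries of the loops eliminated in stage 1 (at v), stage 2 (at w̄₁) and stage 3 (at v);
  -- transitions at level 4 are never entries.
  level : Vtx → Vtx → ℕ
  level v  x₁ = 1
  level v  x₂ = 1
  level v  _  = 3
  level w̄₁ y₁ = 2
  level w̄₁ y₂ = 2
  level _  _  = 4

  Remaining : ℕ → TransitionSet A Vtx
  Remaining k (p , l , q) = Trans (p , l , q) × k ≤ level p q

  hub : ℕ → Vtx
  hub 2 = w̄₁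
  hub _ = v

  -- A topological numbering of the acyclic part that is left once all loop entries are removed.
  rank : Vtx → ℕ
  rank v  = 0
  rank z  = 1
  rank w₂ = 2
  rank x₁ = 3
  rank x₂ = 3
  rank w̄₁ = 4
  rank u  = 5
  rank w₁ = 6
  rank y₁ = 7
  rank y₂ = 7

  hub⊎descent : ∀ {p l q} → Trans (p , l , q) →
                (p ≡ hub (level p q) × 1 ≤ level p q × level p q < 4)
                ⊎ (level p q ≡ 4 × rank q < rank p)
  hub⊎descent v-x₁  = inj₁ (refl , ℕ.≤ᵇ⇒≤ _ _ _ , ℕ.<ᵇ⇒< _ _ _)
  hub⊎descent v-x₂  = inj₁ (refl , ℕ.≤ᵇ⇒≤ _ _ _ , ℕ.<ᵇ⇒< _ _ _)
  hub⊎descent v-y₁  = inj₁ (refl , ℕ.≤ᵇ⇒≤ _ _ _ , ℕ.<ᵇ⇒< _ _ _)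
  hub⊎descent v-y₂  = inj₁ (refl , ℕ.≤ᵇ⇒≤ _ _ _ , ℕ.<ᵇ⇒< _ _ _)
  hub⊎descent v-u   = inj₁ (refl , ℕ.≤ᵇ⇒≤ _ _ _ , ℕ.<ᵇ⇒< _ _ _)
  hub⊎descent w̄₁-y₁ = inj₁ (refl , ℕ.≤ᵇ⇒≤ _ _ _ , ℕ.<ᵇ⇒< _ _ _)
  hub⊎descent w̄₁-y₂ = inj₁ (refl , ℕ.≤ᵇ⇒≤ _ _ _ , ℕ.<ᵇ⇒< _ _ _)
  hub⊎descent w̄₁-x₁ = inj₂ (refl , ℕ.<ᵇ⇒< _ _ _)
  hub⊎descent w̄₁-x₂ = inj₂ (refl , ℕ.<ᵇ⇒< _ _ _)
  hub⊎descent w̄₁-z = inj₂ (refl , ℕ.<ᵇ⇒< _ _ _)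
  hub⊎descent x₁-w₂ = inj₂ (refl , ℕ.<ᵇ⇒< _ _ _)
  hub⊎descent x₁-v = inj₂ (refl , ℕ.<ᵇ⇒< _ _ _)
  hub⊎descent x₂-w₂ = inj₂ (refl , ℕ.<ᵇ⇒< _ _ _)
  hub⊎descent x₂-v = inj₂ (refl , ℕ.<ᵇ⇒< _ _ _)
  hub⊎descent y₁-w₁ = inj₂ (refl , ℕ.<ᵇ⇒< _ _ _)
  hub⊎descent y₁-w̄₁ = inj₂ (refl , ℕ.<ᵇ⇒< _ _ _)
  hub⊎descent y₂-w₁ = inj₂ (refl , ℕ.<ᵇ⇒< _ _ _)
  hub⊎descent y₂-w̄₁ = inj₂ (refl , ℕ.<ᵇ⇒< _ _ _)
  hub⊎descent w₁-u = inj₂ (refl , ℕ.<ᵇ⇒< _ _ _)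
  hub⊎descent w₁-w̄₁ = inj₂ (refl , ℕ.<ᵇ⇒< _ _ _)
  hub⊎descent w₂-z = inj₂ (refl , ℕ.<ᵇ⇒< _ _ _)
  hub⊎descent w₂-v = inj₂ (refl , ℕ.<ᵇ⇒< _ _ _)
  hub⊎descent z-v = inj₂ (refl , ℕ.<ᵇ⇒< _ _ _)
  hub⊎descent u-w̄₁ = inj₂ (refl , ℕ.<ᵇ⇒< _ _ _)

  remains : ∀ {p l q} → Trans (p , l , q) → {T (3 ≤ᵇ level p q)} → StepIn (Remaining 3) p q
  remains t {3≤} = _ , t , ℕ.≤ᵇ⇒≤ _ _ 3≤

  -- Every vertex stays reachable without the entries of levels 1 and 2, so the first two
  -- eliminations lose no vertex.
  from-v : ∀ p → Star (StepIn (Remaining 3)) v p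
  from-v v  = ε
  from-v y₁ = remains v-y₁ ◅ ε
  from-v y₂ = remains v-y₂ ◅ ε
  from-v u  = remains v-u ◅ ε
  from-v w₁ = remains v-y₁ ◅ remains y₁-w₁ ◅ ε
  from-v w̄₁ = remains v-u ◅ remains u-w̄₁ ◅ ε
  from-v z  = remains v-u ◅ remains u-w̄₁ ◅ remains w̄₁-z ◅ ε
  from-v x₁ = remains v-u ◅ remains u-w̄₁ ◅ remains w̄₁-x₁ ◅ ε
  from-v x₂ = remains v-u ◅ remains u-w̄₁ ◅ remains w̄₁-x₂ ◅ ε
  from-v w₂ = remains v-u ◅ remains u-w̄₁ ◅ remains w̄₁-x₁ ◅ remains x₁-w₂ ◅ ε

  from-w₁ : ∀ p → Star (StepIn (Remaining 3)) w₁ p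
  from-w₁ p = remains w₁-w̄₁ ◅ remains w̄₁-z ◅ remains z-v ◅ from-v p

  from-w₂ : ∀ p → Star (StepIn (Remaining 3)) w₂ p
  from-w₂ p = remains w₂-v ◅ from-v p

  reachable-𝒞 : ∀ {s} → (∀ p → Star (StepIn (Remaining 3)) s p) → ∀ p → Reachable 𝒞 s p
  reachable-𝒞 from p = Star.map (map₂ proj₁) (from p)

  -- The 𝟏-bisimilarity of `w₁` and `w₂`

  data _≈_ : Rel Vtx 0ℓ where
    same  : ∀ {p} → p ≈ p
    w₁≈w₂ : w₁ ≈ w₂

  -- `w₁` and `w₂` have identical induced successors, so one ordered pair beyond the identity gives
  -- a 𝟏-bisimulation.
  ≈-forth : ∀ {p q l r} → p ≈ q → Induced 𝒞 p l r → Induced 𝒞 q l r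
  ≈-forth same  i                        = i
  ≈-forth w₁≈w₂ (_ , ε , w₁-u)           = _ , w₂-v ◅ ε , v-u
  ≈-forth w₁≈w₂ (_ , w₁-w̄₁ ◅ ε , w̄₁-x₁) = _ , w₂-v ◅ ε , v-x₁
  ≈-forth w₁≈w₂ (_ , w₁-w̄₁ ◅ ε , w̄₁-x₂) = _ , w₂-v ◅ ε , v-x₂
  ≈-forth w₁≈w₂ (_ , w₁-w̄₁ ◅ ε , w̄₁-y₁) = _ , w₂-v ◅ ε , v-y₁
  ≈-forth w₁≈w₂ (_ , w₁-w̄₁ ◅ ε , w̄₁-y₂) = _ , w₂-v ◅ ε , v-y₂
  ≈-forth w₁≈w₂ (_ , w₁-w̄₁ ◅ ε , w̄₁-z)  = proper w₂-z
  ≈-forth w₁≈w₂ (_ , w₁-w̄₁ ◅ () ◅ _ , _)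

  ≈-back : ∀ {p q l r} → p ≈ q → Induced 𝒞 q l r → Induced 𝒞 p l r
  ≈-back same  i                      = i
  ≈-back w₁≈w₂ (_ , ε , w₂-z)         = _ , w₁-w̄₁ ◅ ε , w̄₁-z
  ≈-back w₁≈w₂ (_ , w₂-v ◅ ε , v-x₁) = _ , w₁-w̄₁ ◅ ε , w̄₁-x₁
  ≈-back w₁≈w₂ (_ , w₂-v ◅ ε , v-x₂) = _ , w₁-w̄₁ ◅ ε , w̄₁-x₂
  ≈-back w₁≈w₂ (_ , w₂-v ◅ ε , v-y₁) = _ , w₁-w̄₁ ◅ ε , w̄₁-y₁
  ≈-back w₁≈w₂ (_ , w₂-v ◅ ε , v-y₂) = _ , w₁-w̄₁ ◅ ε , w̄₁-y₂
  ≈-back w₁≈w₂ (_ , w₂-v ◅ ε , v-u)  = proper w₁-u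
  ≈-back w₁≈w₂ (_ , w₂-v ◅ () ◅ _ , _)

  ≈-isOneBisimulation : IsOneBisimulation 𝒞 𝒞 _≈_
  ≈-isOneBisimulation = record
    { onVertices  = λ _ → tt , tt
    ; startRel    = same
    ; forth       = λ p≈q i → _ , ≈-forth p≈q i , same
    ; back        = λ p≈q i → _ , ≈-back p≈q i , same
    ; termination = λ _ → mk⇔ (λ { (_ , _ , ()) }) (λ { (_ , _ , ()) })
    }

  -- Failure of collapsibility and of joint minimizability

  ¬oneCollapsible : ¬ LLEEPreservinglyOneCollapsible 𝒞
  ¬oneCollapsible (_ , D , collapsed , (B , bisim) , llee) =
    Image.¬LEE D (flip B) (identify same) back forth startRel Bw₁ x₁→w (inj₁ refl) (LLEE⇒LEE llee)
    where
    open IsOneBisimulation bisim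

    -- Going from `D` to `𝒞`, across `≈` and back is a 𝟏-bisimulation of `D` with itself, to which
    -- collapsedness applies.
    identify : ∀ {p q y y′} → p ≈ q → B y p → B y′ q → y ≡ y′
    identify p≈q Byp By′q =
      collapsed (_ , compose bisim (compose ≈-isOneBisimulation (converse bisim))
                   , _ , Byp , _ , p≈q , By′q)

    image-w₁ : ∃[ y ] B y w₁
    image-w₁ = let _ , _ , By₁ = back startRel (proper v-y₁)
                   y , _ , Bw₁ = back By₁ (proper y₁-w₁)
               in y , Bw₁

    Bw₁ : B (proj₁ image-w₁) w₁
    Bw₁ = proj₂ image-w₁

    x₁→w : ∀ {y} → B y x₁ → Induced D y a₁ (proj₁ image-w₁)
    x₁→w Bx₁ with back Bx₁ (proper x₁-w₂)
    ... | _ , i , Bw₂ rewrite identify w₁≈w₂ Bw₁ Bw₂ = i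

  ¬collapsible : ¬ LLEEPreservinglyCollapsible 𝒞
  ¬collapsible (_ , D , (collapsed , _) , rest) = ¬oneCollapsible (_ , D , collapsed , rest)

  w₂-a-target : ∀ {l p} → Induced 𝒞 w₂ l p → l ≡ a → p ≡ x₁ ⊎ p ≡ x₂
  w₂-a-target (_ , w₂-v ◅ ε , v-x₁) _   = inj₁ refl
  w₂-a-target (_ , w₂-v ◅ ε , v-x₂) _   = inj₂ refl
  w₂-a-target (_ , w₂-v ◅ ε , v-y₁) c≡a = contradiction c≡a (distinct-labels {2F} {0F} λ ())
  w₂-a-target (_ , w₂-v ◅ ε , v-y₂) c≡a = contradiction c≡a (distinct-labels {2F} {0F} λ ())
  w₂-a-target (_ , w₂-v ◅ ε , v-u)  b≡a = contradiction b≡a (distinct-labels {1F} {0F} λ ())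
  w₂-a-target (_ , ε , w₂-z)        d≡a = contradiction d≡a (distinct-labels {3F} {0F} λ ())
  w₂-a-target (_ , w₂-v ◅ () ◅ _ , _)

  x₂-enables : ∀ {l p} → Induced 𝒞 x₂ l p → l ≡ a₂
  x₂-enables (_ , ε , x₂-w₂) = refl
  x₂-enables (_ , ε , x₂-v)  = refl
  x₂-enables (_ , () ◅ _ , _)

  -- `start D` is the image of `w₁` under `B₁` and of `w₂` under `B₂`, so it takes the place of `Ŵ`.
  ¬jointlyMinimizable : ¬ LLEEPreservinglyJointlyMinimizable (𝒞-at w₁) (𝒞-at w₂)
  ¬jointlyMinimizable (_ , D , llee , (B₁ , bisim₁ , functional₁) , (B₂ , bisim₂ , functional₂)) =
    Image.¬LEE D B₁ functional₁ forth back B₁v (B₁.startRel) x₁→w (inj₂ refl) (LLEE⇒LEE llee)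
    where
    module B₁ = IsOneBisimulation bisim₁
    module B₂ = IsOneBisimulation bisim₂

    at₁ : ∀ {p l q} → Induced 𝒞 p l q → Induced (𝒞-at w₁) p l q
    at₁ = generated⁺ 𝒞 (reachable-𝒞 from-w₁)

    at₂ : ∀ {p l q} → Induced 𝒞 p l q → Induced (𝒞-at w₂) p l q
    at₂ = generated⁺ 𝒞 (reachable-𝒞 from-w₂)

    forth : ∀ {p l q y} → B₁ p y → Induced 𝒞 p l q → ∃[ y′ ] (Induced D y l y′ × B₁ q y′)
    forth Bp i = B₁.forth Bp (at₁ i)

    back : ∀ {p l y y′} → B₁ p y → Induced D y l y′ → ∃[ q ] (Induced 𝒞 p l q × B₁ q y′)
    back Bp i = let _ , j , Bq = B₁.back Bp i in _ , generated⁻ 𝒞 (reachable-𝒞 from-w₁) j , Bq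

    w₁-x₁ : Induced 𝒞 w₁ a x₁
    w₁-x₁ = _ , w₁-w̄₁ ◅ ε , w̄₁-x₁

    image-v : ∃[ y ] B₁ v y
    image-v = let _ , _ , B₁x₁ = forth B₁.startRel w₁-x₁
                  y , _ , B₁v  = forth B₁x₁ (proper x₁-v)
              in y , B₁v

    B₁v : B₁ v (proj₁ image-v)
    B₁v = proj₂ image-v

    -- The vertex start D is related to w₂ by B₂, hence so is the image of x₁ under B₁ to
    -- some a-successor of w₂, which can only be x₁ since a₁ ≢ a₂.
    B₂x₁ : ∀ {y} → B₁ x₁ y → B₂ x₁ y
    B₂x₁ B₁x₁ with forth B₁.startRel w₁-x₁
    ... | _ , s→y , B₁x₁′ with functional₁ B₁x₁ B₁x₁′ | B₂.back B₂.startRel s→y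
    ...   | refl | p , w₂→p , B₂p
      with w₂-a-target (generated⁻ 𝒞 (reachable-𝒞 from-w₂) w₂→p) refl
    ...     | inj₁ refl = B₂p
    ...     | inj₂ refl =
      let _ , y→v , _ = forth B₁x₁ (proper x₁-v)
          _ , x₂→ , _ = B₂.back B₂p y→v
      in contradiction (x₂-enables (generated⁻ 𝒞 (reachable-𝒞 from-w₂) x₂→))
                       (distinct-labels {6F} {7F} λ ())

    x₁→w : ∀ {y} → B₁ x₁ y → Induced D y a₁ (start D)
    x₁→w B₁x₁ with B₂.forth (B₂x₁ B₁x₁) (at₂ (proper x₁-w₂))
    ... | _ , i , B₂w₂ rewrite functional₂ B₂.startRel B₂w₂ = i

  at-bisimilar : OneBisimilar (𝒞-at w₁) (𝒞-at w₂)
  at-bisimilar = _≈_ , record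
    { onVertices  = λ _ → reach₁ _ , reach₂ _
    ; startRel    = w₁≈w₂
    ; forth       = λ p≈q i → _ , generated⁺ 𝒞 reach₂ (≈-forth p≈q (generated⁻ 𝒞 reach₁ i)) , same
    ; back        = λ p≈q i → _ , generated⁺ 𝒞 reach₁ (≈-back p≈q (generated⁻ 𝒞 reach₂ i)) , same
    ; termination = λ _ → mk⇔ (λ { (_ , _ , _ , ()) }) (λ { (_ , _ , _ , ()) })
    }
    where
    reach₁ = reachable-𝒞 from-w₁
    reach₂ = reachable-𝒞 from-w₂

  -- LLEE by eliminating three layers

  _≟_ : DecidableEquality Vtx
  _≟_ = Finite⇒≟ finite-Vtx

  1≤level : ∀ {p l q} → Trans (p , l , q) → 1 ≤ level p q
  1≤level t with hub⊎descent t
  ... | inj₁ (_ , 1≤ , _)              = 1≤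
  ... | inj₂ (level≡4 , _) rewrite level≡4 = ℕ.≤ᵇ⇒≤ 1 4 _

  -- A transition of level at least `k` that leaves no hub of a stage from `k` to 3 must have level
  -- 4.
  descent : ∀ {k p l q} → Trans (p , l , q) → k ≤ level p q →
            (∀ j → k ≤ j → j < 4 → p ≢ hub j) → rank q < rank p
  descent t k≤ no-hub with hub⊎descent t
  ... | inj₁ (p≡hub , _ , <4) = contradiction p≡hub (no-hub _ k≤ <4)
  ... | inj₂ (_ , rank<)      = rank<

  no-infinite-descent : ∀ (f : ℕ → Vtx) → ¬ (∀ i → rank (f (suc i)) < rank (f i))
  no-infinite-descent f desc = go _ 0 (ℕ.n<1+n _)
    where
    go : ∀ n i → ¬ rank (f i) < n
    go (suc n) i (s≤s ≤n) = go n (suc i) (ℕ.<-≤-trans (desc i) ≤n)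

  -- Successors are chosen at level 3 or above, so the loops of all three stages can be continued
  -- forever, as (L1) asks.
  onward : ∀ p → ∃[ l ] ∃[ q ] Remaining 3 (p , l , q)
  onward v  = _ , _ , v-u , ℕ.≤ᵇ⇒≤ _ _ _
  onward w̄₁ = _ , _ , w̄₁-z , ℕ.≤ᵇ⇒≤ _ _ _
  onward x₁ = _ , _ , x₁-v , ℕ.≤ᵇ⇒≤ _ _ _
  onward x₂ = _ , _ , x₂-v , ℕ.≤ᵇ⇒≤ _ _ _
  onward y₁ = _ , _ , y₁-w̄₁ , ℕ.≤ᵇ⇒≤ _ _ _
  onward y₂ = _ , _ , y₂-w̄₁ , ℕ.≤ᵇ⇒≤ _ _ _
  onward w₁ = _ , _ , w₁-u , ℕ.≤ᵇ⇒≤ _ _ _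
  onward w₂ = _ , _ , w₂-z , ℕ.≤ᵇ⇒≤ _ _ _
  onward z  = _ , _ , z-v , ℕ.≤ᵇ⇒≤ _ _ _
  onward u  = _ , _ , u-w̄₁ , ℕ.≤ᵇ⇒≤ _ _ _

  -- Inside contains the vertices of the loop eliminated in stage k, except its start hub k.
  record Layer (k : ℕ) : Set₁ where
    field
      k≤3     : k ≤ 3
      entry   : ∃[ l ] ∃[ q ] (Trans (hub k , l , q) × level (hub k) q ≡ k)
      Inside  : Pred Vtx 0ℓ
      entered : ∀ {l q} → Trans (hub k , l , q) → level (hub k) q ≡ k → Inside q
      closed  : ∀ {p l q} → Inside p → Trans (p , l , q) → q ≡ hub k ⊎ Inside q
      -- Excluding the hubs of later stages too makes the rank fall along the body.
      no-hub  : ∀ {p} → Inside p → ∀ j → k ≤ j → j < 4 → p ≢ hub j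

    hub∉Inside : ¬ Inside (hub k)
    hub∉Inside inside = no-hub inside k ℕ.≤-refl (s≤s k≤3) refl

  record Stage (k : ℕ) (C : OneChart A Vtx) : Set where
    field
      sound    : Trans[ C ] ⊆ Remaining k
      complete : Remaining k ⊆ Trans[ C ]
      no-term  : ∀ {p} → ¬ term C p

  module _ {k : ℕ} {C : OneChart A Vtx} (layer : Layer k) (stage : Stage k C) where

    open Layer layer
    open Stage stage

    entrySet : EntrySet C
    entrySet = record
      { v        = hub k
      ; U        = λ (p , l , q) → Trans (p , l , q) × p ≡ hub k × level p q ≡ k
      ; U⊆trans  = λ (t , _ , level≡k) → complete (t , ℕ.≤-reflexive (sym level≡k))
      ; U-from-v = λ (_ , p≡hub , _) → p≡hub
      ; nonempty = let _ , _ , t , level≡k = entry in _ , t , refl , level≡k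
      }

    visited-inside : ∀ {p} → Visited entrySet p → p ≡ hub k ⊎ Inside p
    visited-inside (enter (t , refl , level≡k)) = inj₂ (entered t level≡k)
    visited-inside (continue vis p≢hub t) with visited-inside vis
    ... | inj₁ p≡hub  = contradiction p≡hub p≢hub
    ... | inj₂ inside = closed inside (proj₁ (sound t))

    loop-unending : Unending (Step (loopSubchart entrySet)) (LoopVertex entrySet)
    loop-unending {p} member with p ≟ hub k | member
    ... | yes refl | _ =
      let l , q , t , level≡k = entry
          ut                  = t , refl , level≡k
      in q , (l , inj₁ ut) , inj₂ (enter ut)
    ... | no p≢hub | inj₁ p≡hub = contradiction p≡hub p≢hub
    ... | no p≢hub | inj₂ vis   =
      let l , q , t , 3≤ = onward p
          t′             = complete (t , ℕ.≤-trans k≤3 3≤)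
      in q , (l , inj₂ (vis , p≢hub , t′)) , inj₂ (continue vis p≢hub t′)

    loop-returns : ∀ p → IsInfinitePath (Step (loopSubchart entrySet)) p → p 0 ≡ hub k →
                   ∃[ n ] p (suc n) ≡ hub k
    loop-returns p steps p0≡hub with steps 0
    ... | _ , inj₂ (_ , p0≢hub , _)  = contradiction p0≡hub p0≢hub
    ... | l , inj₁ (t , _ , level≡k) =
      -- The descent starts at index 1, after the entry transition; the rank bounds the number of
      -- steps before the hub is met.
      go _ 1 (ℕ.n<1+n _)
         (entered (subst (λ s → Trans (s , l , p 1)) p0≡hub t)
                  (subst (λ s → level s (p 1) ≡ k) p0≡hub level≡k))
      where
      go : ∀ n i → rank (p i) < n → Inside (p i) → ∃[ m ] p (suc m) ≡ hub k
      go (suc n) i (s≤s ≤n) inside with steps i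
      ... | _ , inj₁ (_ , pi≡hub , _) = contradiction (subst Inside pi≡hub inside) hub∉Inside
      ... | _ , inj₂ (_ , _ , t) with closed inside (proj₁ (sound t))
      ...   | inj₁ eq      = i , eq
      ...   | inj₂ inside′ =
        let t′ , k≤ = sound t
        in go n (suc i) (ℕ.<-≤-trans (descent t′ k≤ (no-hub inside)) ≤n) inside′

    loop : LoopSubchart C
    loop = record
      { entries     = entrySet
      ; isLoopChart = record
          { L1 = let p , steps , p0≡hub , _ = unending-path loop-unending (inj₁ refl)
                 in p , steps , p0≡hub
          ; L2 = loop-returns
          ; L3 = λ (_ , t) → contradiction t no-term
          }
      }

    eliminate-sound : Trans[ eliminate loop ] ⊆ Remaining (suc k)
    eliminate-sound (_ , t , ¬entry) with sound t
    ... | t′ , k≤ = t′ , ℕ.≤∧≢⇒< k≤ λ k≡level → not-entry (hub⊎descent t′) (sym k≡level)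
      where
      not-entry : _ → level _ _ ≢ k
      not-entry (inj₁ (p≡hub , _)) refl = ¬entry (t′ , p≡hub , refl)
      not-entry (inj₂ (level≡4 , _)) refl =
        contradiction (subst (_≤ 3) level≡4 k≤3) (ℕ.<⇒≱ (ℕ.n<1+n 3))

    -- For `k < 3` the transitions of level 3 and above, which connect all vertices to the start,
    -- are kept.
    eliminate-stage : k < 3 → (∀ p → Star (StepIn (Remaining 3)) (start C) p) →
                      Stage (suc k) (eliminate loop)
    eliminate-stage k<3 connected = record
      { sound    = eliminate-sound
      ; complete = λ r →
          Star.map (map₂ (λ (t , 3≤) → kept (t , ℕ.≤-trans k<3 3≤))) (connected _) , kept r
      ; no-term  = λ (_ , t) → no-term t
      }
      where
      kept : ∀ {t} → Remaining (suc k) t → Trans[ removeTransitions C (U loop) ] t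
      kept (t , k<) = complete (t , ℕ.<⇒≤ k<) , λ (_ , _ , level≡k) → ℕ.<⇒≢ k< (sym level≡k)

  data Inside₁ : Pred Vtx 0ℓ where
    in-x₁ : Inside₁ x₁
    in-x₂ : Inside₁ x₂
    in-w₂ : Inside₁ w₂
    in-z  : Inside₁ z

  layer₁ : Layer 1
  layer₁ = record
    { k≤3     = s≤s z≤n
    ; entry   = _ , _ , v-x₁ , refl
    ; Inside  = Inside₁
    ; entered = λ { v-x₁ _ → in-x₁ ; v-x₂ _ → in-x₂ ; v-y₁ () ; v-y₂ () ; v-u () }
    ; closed  = λ { in-x₁ x₁-w₂ → inj₂ in-w₂ ; in-x₁ x₁-v → inj₁ refl
                  ; in-x₂ x₂-w₂ → inj₂ in-w₂ ; in-x₂ x₂-v → inj₁ refl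
                  ; in-w₂ w₂-z → inj₂ in-z ; in-w₂ w₂-v → inj₁ refl
                  ; in-z z-v → inj₁ refl }
    ; no-hub  = λ inside j _ _ p≡hub → not-hub j (subst Inside₁ p≡hub inside)
    }
    where
    not-hub : ∀ j → ¬ Inside₁ (hub j)
    not-hub 0                   ()
    not-hub 1                   ()
    not-hub 2                   ()
    not-hub (suc (suc (suc _))) ()

  data Inside₂ : Pred Vtx 0ℓ where
    in-y₁ : Inside₂ y₁
    in-y₂ : Inside₂ y₂
    in-w₁ : Inside₂ w₁
    in-u  : Inside₂ u

  layer₂ : Layer 2
  layer₂ = record
    { k≤3     = s≤s (s≤s z≤n)
    ; entry   = _ , _ , w̄₁-y₁ , refl
    ; Inside  = Inside₂
    ; entered = λ { w̄₁-y₁ _ → in-y₁ ; w̄₁-y₂ _ → in-y₂ ; w̄₁-x₁ () ; w̄₁-x₂ () ; w̄₁-z () }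
    ; closed  = λ { in-y₁ y₁-w₁ → inj₂ in-w₁ ; in-y₁ y₁-w̄₁ → inj₁ refl
                  ; in-y₂ y₂-w₁ → inj₂ in-w₁ ; in-y₂ y₂-w̄₁ → inj₁ refl
                  ; in-w₁ w₁-u → inj₂ in-u ; in-w₁ w₁-w̄₁ → inj₁ refl
                  ; in-u u-w̄₁ → inj₁ refl }
    ; no-hub  = λ inside j _ _ p≡hub → not-hub j (subst Inside₂ p≡hub inside)
    }
    where
    not-hub : ∀ j → ¬ Inside₂ (hub j)
    not-hub 0                   ()
    not-hub 1                   ()
    not-hub 2                   ()
    not-hub (suc (suc (suc _))) ()

  layer₃ : Layer 3
  layer₃ = record
    { k≤3     = ℕ.≤-refl
    ; entry   = _ , _ , v-u , refl
    ; Inside  = _≢ v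
    ; entered = λ { v-x₁ () ; v-x₂ () ; v-y₁ _ () ; v-y₂ _ () ; v-u _ () }
    ; closed  = λ {_} {_} {q} _ _ → toSum (q ≟ v)
    ; no-hub  = λ { p≢v (suc (suc (suc _))) _ _ → p≢v ; _ 0 () ; _ 1 (s≤s ()) ; _ 2 (s≤s (s≤s ())) }
    }

  stage₁⇒LLEE : ∀ {C} → Stage 1 C → (∀ p → Star (StepIn (Remaining 3)) (start C) p) → LLEE C
  stage₁⇒LLEE {C} stage₁ connected =
    _ , S₁ ∷ S₂ ∷ S₃ ∷ [] , (disjoint₁ , disjoint₂ , disjoint₃ , tt) , finite
    where
    S₁ : LoopSubchart C
    S₁ = loop layer₁ stage₁

    stage₂ : Stage 2 (eliminate S₁)
    stage₂ = eliminate-stage layer₁ stage₁ (ℕ.≤ᵇ⇒≤ 2 3 _) connected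

    S₂ : LoopSubchart (eliminate S₁)
    S₂ = loop layer₂ stage₂

    stage₃ : Stage 3 (eliminate S₂)
    stage₃ = eliminate-stage layer₂ stage₂ (ℕ.≤ᵇ⇒≤ 3 3 _) connected

    S₃ : LoopSubchart (eliminate S₂)
    S₃ = loop layer₃ stage₃

    w̄₁∉S₁ : ¬ Visited (entries S₁) w̄₁
    w̄₁∉S₁ vis with visited-inside layer₁ stage₁ vis
    ... | inj₁ ()
    ... | inj₂ ()

    v∉S₂ : ¬ Visited (entries S₂) v
    v∉S₂ vis with visited-inside layer₂ stage₂ vis
    ... | inj₁ ()
    ... | inj₂ ()

    disjoint₁ : U S₁ ⊥ ∅
    disjoint₁ (_ , ())

    disjoint₂ : U S₂ ⊥ (∅ ∪ body S₁)
    disjoint₂ (_ , inj₁ ())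
    disjoint₂ ((_ , refl , _) , inj₂ (vis , _)) = w̄₁∉S₁ vis

    -- Entries of `S₃` leave `v`. The body of `S₁` has no transition from its own hub `v`, and `S₂`
    -- never visits `v`.
    disjoint₃ : U S₃ ⊥ ((∅ ∪ body S₁) ∪ body S₂)
    disjoint₃ (_ , inj₁ (inj₁ ()))
    disjoint₃ ((_ , p≡v , _) , inj₁ (inj₂ (_ , p≢v , _))) = p≢v p≡v
    disjoint₃ ((_ , refl , _) , inj₂ (vis , _)) = v∉S₂ vis

    finite : ¬ HasInfinitePath (Step (eliminate S₃))
    finite (p , steps) = no-infinite-descent p λ i →
      -- Only level 4 is left, and the range of hubs from 4 to 3 is empty, so every step lowers the
      -- rank.
      let t , 4≤ = eliminate-sound layer₃ stage₃ (proj₂ (steps i))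
      in descent t 4≤ λ j 4≤j j<4 → contradiction 4≤j (ℕ.<⇒≱ j<4)

  LLEE-𝒞 : LLEE 𝒞
  LLEE-𝒞 = stage₁⇒LLEE
    record { sound = λ t → t , 1≤level t ; complete = proj₁ ; no-term = λ () } from-v

  LLEE-at : ∀ {s} → (∀ p → Star (StepIn (Remaining 3)) s p) → LLEE (𝒞-at s)
  LLEE-at connected = stage₁⇒LLEE
    record { sound    = λ (_ , t) → t , 1≤level t
           ; complete = λ (t , _) → reachable-𝒞 connected _ , t
           ; no-term  = λ { (_ , ()) } }
    connected

  -- The 𝟏-transitions of `𝒞` lead to `w̄₁` and `v`, from which no 𝟏-transition departs.
  weaklyGuarded : ∀ {C : OneChart A Vtx} → Trans[ C ] ⊆ Trans → WeaklyGuarded C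
  weaklyGuarded C⊆ (p , steps) = no-two (C⊆ (steps 0)) (C⊆ (steps 1))
    where
    no-two : ∀ {p q r} → Trans (p , 𝟏 , q) → ¬ Trans (q , 𝟏 , r)
    no-two w₁-w̄₁ ()
    no-two w₂-v   ()

  𝒞-witnesses : WeaklyGuarded 𝒞 × LLEE 𝒞
    × ¬ LLEEPreservinglyOneCollapsible 𝒞 × ¬ LLEEPreservinglyCollapsible 𝒞
  𝒞-witnesses = weaklyGuarded {𝒞} id , LLEE-𝒞 , ¬oneCollapsible , ¬collapsible

  𝒞-at-witnesses : WeaklyGuarded (𝒞-at w₁) × LLEE (𝒞-at w₁)
    × WeaklyGuarded (𝒞-at w₂) × LLEE (𝒞-at w₂)
    × OneBisimilar (𝒞-at w₁) (𝒞-at w₂)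
    × ¬ LLEEPreservinglyJointlyMinimizable (𝒞-at w₁) (𝒞-at w₂)
  𝒞-at-witnesses = weaklyGuarded {𝒞-at w₁} proj₂ , LLEE-at from-w₁
    , weaklyGuarded {𝒞-at w₂} proj₂ , LLEE-at from-w₂
    , at-bisimilar , ¬jointlyMinimizable

proposition6p1 : (¬ (∀ {A X : Set} (C : OneChart A X) → WeaklyGuarded C → LLEE C →
    LLEEPreservinglyOneCollapsible C))
    × (¬ (∀ {A X : Set} (C : OneChart A X) → WeaklyGuarded C → LLEE C →
    LLEEPreservinglyCollapsible C))
    × (¬ (∀ {A X₁ X₂ : Set} (C₁ : OneChart A X₁) (C₂ : OneChart A X₂) →
    WeaklyGuarded C₁ → LLEE C₁ → WeaklyGuarded C₂ → LLEE C₂ → OneBisimilar C₁ C₂ →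
    LLEEPreservinglyJointlyMinimizable C₁ C₂))
    × (∀ {A : Set} (finite-A : Finite A) (a b c d e f a₁ a₂ c₁ c₂ : A) →
    Unique (a ∷ b ∷ c ∷ d ∷ e ∷ f ∷ a₁ ∷ a₂ ∷ c₁ ∷ c₂ ∷ []) →
    let open Counterexample finite-A a b c d e f a₁ a₂ c₁ c₂ in
    (WeaklyGuarded 𝒞 × LLEE 𝒞
    × ¬ LLEEPreservinglyOneCollapsible 𝒞
    × ¬ LLEEPreservinglyCollapsible 𝒞)
    × (WeaklyGuarded (𝒞-at w₁) × LLEE (𝒞-at w₁)
    × WeaklyGuarded (𝒞-at w₂) × LLEE (𝒞-at w₂)
    × OneBisimilar (𝒞-at w₁) (𝒞-at w₂)
    × ¬ LLEEPreservinglyJointlyMinimizable (𝒞-at w₁) (𝒞-at w₂)))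
proposition6p1 =
    (λ all → let guarded , llee , ¬one , _ = W₁₀.𝒞-witnesses in ¬one (all _ guarded llee))
  , (λ all → let guarded , llee , _ , ¬coll = W₁₀.𝒞-witnesses in ¬coll (all _ guarded llee))
  , (λ all → let guarded₁ , llee₁ , guarded₂ , llee₂ , bisimilar , ¬joint = W₁₀.𝒞-at-witnesses
             in ¬joint (all _ _ guarded₁ llee₁ guarded₂ llee₂ bisimilar))
  , λ finite-A a b c d e f a₁ a₂ c₁ c₂ distinct →
      let module W = Witness finite-A a b c d e f a₁ a₂ c₁ c₂ distinct
      in W.𝒞-witnesses , W.𝒞-at-witnesses
  where
  module W₁₀ = Witness (10 , ↔-id (Fin 10)) 0F 1F 2F 3F 4F 5F 6F 7F 8F 9F (allFin⁺ 10)
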